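{- Let $k,n\in\mathbb{N}$ with $2n\ge k$. For $i\in\mathbb{N}$ put $x_i=\frac{1+(-1)^{i}}{2}\cdot\frac{[(i-1)!!]^2}{i+1}$ (so $(x_1,x_2,x_3,x_4,x_5,x_6,\dots)=(0,\tfrac13,0,\tfrac95,0,\tfrac{225}{7},\dots)$). Then \[ \mathrm{B}_{2n,k}\bigl(x_1,x_2,\dots,x_{2n-k+1}\bigr)=(-1)^{n+k}\frac{(4n)!!}{(2n+k)!}\sum_{q=1}^{k}(-1)^{q}\binom{2n+k}{k-q}\,Q(q,2n;2). \]
   Context: Partial Bell polynomials: for $n\ge k\ge0$, \[ \mathrm{B}_{n,k}(x_1,\dots,x_{n-k+1})=\sum\frac{n!}{\prod_{i=1}^{n-k+1}\ell_i!}\prod_{i=1}^{n-k+1}\left(\frac{x_i}{i!}\right)^{\ell_i}, \] the sum over all $(\ell_1,\dots,\ell_{n-k+1})\in\mathbb{N}_0^{n-k+1}$ with $\sum_i i\ell_i=n$ and $\sum_i\ell_i=k$. Double factorials: $(2p)!!=2^p p!$, $(2p-1)!!=1\cdot3\cdots(2p-1)$, $0!!=(-1)!!=1$. $s(n,k)$ denotes the signed Stirling numbers of the first kind, defined by $\frac{[\ln(1+x)]^k}{k!}=\sum_{n=k}^\infty s(n,k)\frac{x^n}{n!}$ for $|x|<1$; equivalently $\prod_{j=0}^{n-1}(z-j)=\sum_{k=0}^n s(n,k)z^k$. For $m\in\mathbb{N}$, $k\in\mathbb{N}_0$ and $\alpha\in\mathbb{R}$ define \[ Q(m,k;\alpha)=\sum_{\ell=0}^{k}\binom{m+\ell-1}{m-1}\,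 s(m+k-1,m+\ell-1)\left(\frac{m+k-\alpha}{2}\right)^{\ell}, \] with the convention $0^0=1$. -}

module Defs where

open import Algebra.Bundles using (CommutativeRing)
open import Algebra.Properties.CommutativeMonoid.Sum as Sum using ()
open import Data.Fin using (Fin; zero; suc; toℕ)
open import Data.Integer using (+_)
open import Data.List as List using (List; cartesianProductWith; filter; upTo)
open import Data.Nat as ℕ using (ℕ; zero; suc; _∸_; _!; NonZero)
import Data.Nat.Properties as ℕₚ
open import Data.Nat.Combinatorics using (_C_)
open import Data.Product using (_×_)
open import Data.Rational using (ℚ; 0ℚ; 1ℚ; ½; _+_; _-_; _*_; -_; _/_)
open import Data.Rational.Properties using (+-0-commutativeMonoid; *-1-commutativeMonoid; +-*-commutativeRing)
open import Data.Vec.Functional using (Vector; []; _∷_)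
open import Function using (_∘_)
open import Relation.Binary.PropositionalEquality using (_≡_)
open import Relation.Nullary using (Dec)
open import Relation.Nullary.Decidable using (_×-dec_)

-- x ^ 0 reduces to 1ℚ for every x, including 0ℚ.
open import Algebra.Properties.Semiring.Exp (CommutativeRing.semiring +-*-commutativeRing) public using (_^_)

open Sum +-0-commutativeMonoid public using (sum-syntax; sum⁺-syntax)
open Sum *-1-commutativeMonoid public using () renaming (sum to ∏ℚ)
open Sum ℕₚ.+-0-commutativeMonoid public using () renaming (sum to ∑ℕ)
open Sum ℕₚ.*-1-commutativeMonoid public using () renaming (sum to ∏ℕ)

fromℕ : ℕ → ℚ
fromℕ n = + n / 1

infixl 7 _/!_
_/!_ : ℕ → ℕ → ℚ
a /! m = (+ a / (m !)) {{m ℕₚ.!≢0}}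

infix 9 _!!
_!! : ℕ → ℕ
zero !!          = 1
suc zero !!      = 1
suc (suc n) !!   = suc (suc n) ℕ.* n !!

-- A vector indexed by Fin N is read as (v₁ , … , v_N): the entry at i : Fin N
-- carries the mathematical index suc (toℕ i).

-- All vectors in {0 , … , b}ᴺ, each listed once.
tuples : ℕ → (N : ℕ) → List (Vector ℕ N)
tuples b zero    = List.[ [] ]
tuples b (suc N) = cartesianProductWith _∷_ (upTo (suc b)) (tuples b N)

IsBellIndex : (n k : ℕ) {N : ℕ} → Vector ℕ N → Set
IsBellIndex n k ℓ = ∑ℕ (λ i → suc (toℕ i) ℕ.* ℓ i) ≡ n × ∑ℕ ℓ ≡ k

isBellIndex? : ∀ n k {N} (ℓ : Vector ℕ N) → Dec (IsBellIndex n k ℓ)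
isBellIndex? n k ℓ = (_ ℕₚ.≟ n) ×-dec (_ ℕₚ.≟ k)

-- Bounding the entries by k loses nothing, since they are required to sum to k.
bellIndices : (n k : ℕ) → List (Vector ℕ (suc (n ∸ k)))
bellIndices n k = filter (isBellIndex? n k) (tuples k (suc (n ∸ k)))

∏!≢0 : ∀ {N} (ℓ : Vector ℕ N) → NonZero (∏ℕ (_! ∘ ℓ))
∏!≢0 {zero}  ℓ = _
∏!≢0 {suc N} ℓ = ℕₚ.m*n≢0 (ℓ zero !) _ {{ℓ zero ℕₚ.!≢0}} {{∏!≢0 (ℓ ∘ suc)}}

bellTerm : (n : ℕ) {N : ℕ} → Vector ℚ N → Vector ℕ N → ℚ
bellTerm n x ℓ =
  (+ (n !) / ∏ℕ (_! ∘ ℓ)) {{∏!≢0 ℓ}}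
  * ∏ℚ (λ i → (x i * (1 /! suc (toℕ i))) ^ ℓ i)

-- The partial Bell polynomial B_{n,k}(x₁ , … , x_{n-k+1}); meaningful for k ≤ n.
bell : (n k : ℕ) → Vector ℚ (suc (n ∸ k)) → ℚ
bell n k x = List.foldr _+_ 0ℚ (List.map (bellTerm n x) (bellIndices n k))

-- Polynomials in one variable z, as the sequence of their coefficients.
Poly : Set
Poly = ℕ → ℚ

1ₚ : Poly
1ₚ zero    = 1ℚ
1ₚ (suc _) = 0ℚ

infixl 7 _*ₚ_
_*ₚ_ : Poly → Poly → Poly
(p *ₚ r) n = ∑[ i ≤ n ] (p (toℕ i) * r (n ∸ toℕ i))

z-_ : ℚ → Poly
(z- a) zero          = - a
(z- a) (suc zero)    = 1ℚ
(z- a) (suc (suc _)) = 0ℚ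

-- ∏_{j=0}^{n-1} (z - j)
fallingFactorial : ℕ → Poly
fallingFactorial zero    = 1ₚ
fallingFactorial (suc n) = fallingFactorial n *ₚ (z- fromℕ n)

-- Signed Stirling numbers of the first kind: s n k is the coefficient of zᵏ in
-- z (z - 1) ⋯ (z - n + 1).
s : ℕ → ℕ → ℚ
s n k = fallingFactorial n k

-- Meaningful for m ≥ 1, where the truncated subtractions are exact.
Q : (m k : ℕ) → ℚ → ℚ
Q m k α =
  ∑[ i ≤ k ]
    (let ℓ = toℕ i in
     fromℕ ((m ℕ.+ ℓ ∸ 1) C (m ∸ 1))
     * s (m ℕ.+ k ∸ 1) (m ℕ.+ ℓ ∸ 1)
     * ((fromℕ (m ℕ.+ k) - α) * ½) ^ ℓ)

-- For i ≥ 1: (1 + (-1)ⁱ)/2 · [(i-1)!!]² / (i+1).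
x : ℕ → ℚ
x i = ((1ℚ + (- 1ℚ) ^ i) * ½) * (+ (((i ∸ 1) !!) ℕ.^ 2) / suc i)

{-# OPTIONS --safe #-}
module Submission where

-- The numbers x_i / i! are the Taylor coefficients of arcsin t / t - 1, so B_{2n,k} is (2n)! times
-- the coefficient of t^{2n} in (arcsin t / t - 1)^k / k!, and expanding (arcsin t - t)^k reduces
-- the claim to the coefficients of arcsin^q. With θ = t d/dt, the equations
-- (1 - t²) θ² arcsin = θ arcsin and (1 - t²) (θ arcsin)² = t² give a two-term recurrence for
-- these. On the other side Q(q,2n;2) is, by Taylor's formula, the coefficient of z^{q-1} in
-- ∏_{j<N} (z + (N-1)/2 - j) with N = q - 1 + 2n, and these centred products satisfy the same
-- recurrence up to the factor -4, since passing from N to N + 2 multiplies them by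
-- z² - ((N+1)/2)².

open import Defs
open import Algebra.Bundles using (CommutativeRing; CommutativeSemiring)
import Algebra.Properties.CommutativeSemiring.Binomial as Binomial
import Algebra.Properties.CommutativeSemiring.Exp as SemiringExp
import Algebra.Properties.Group as GroupProperties
import Algebra.Properties.Semiring.Mult as SemiringMult
import Algebra.Properties.Semiring.Sum as SemiringSum
import Algebra.Solver.Ring.NaturalCoefficients.Default as SemiringSolver
open import Data.Bool using (Bool; true; false; if_then_else_; _∧_)
open import Data.Fin using (zero; suc; toℕ)
open import Data.Fin.Properties using (toℕ<n)
open import Data.Integer as ℤ using (+_)
import Data.Integer.Properties as ℤₚ
open import Data.List as List using (List; []; _∷_; _++_; cartesianProductWith; filter; upTo; applyUpTo)
open import Data.Nat as ℕ using (ℕ; zero; suc; _∸_; _≤_; _<_; z≤n; s≤s; _!; _≡ᵇ_; NonZero)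
open import Data.Nat.Combinatorics using (_C_; nCk≡n!/k![n-k]!; nCk+nC[k+1]≡[n+1]C[k+1]; k>n⇒nCk≡0; k![n∸k]!∣n!)
open import Data.Nat.DivMod using (m/n*n≡m)
import Data.Nat.Properties as ℕₚ
open import Data.Product using (_,_)
open import Data.Rational using (ℚ; 0ℚ; 1ℚ; ½; _+_; _-_; _*_; -_; _/_; toℚᵘ; fromℚᵘ)
import Data.Rational.Properties as ℚₚ
open import Data.Rational.Unnormalised as ℚᵘ using (mkℚᵘ; *≡*)
import Data.Rational.Unnormalised.Properties as ℚᵘₚ
open import Data.Vec.Functional as Vector using (Vector)
open import Function using (_∘_)
open import Level using (0ℓ)
open import Relation.Binary.PropositionalEquality
import Relation.Binary.Reasoning.Setoid as SetoidReasoning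
open import Relation.Nullary using (yes; no)
open import Relation.Nullary.Decidable using (dec⇒maybe; does)
open import Relation.Unary using (Decidable)
import Data.Nat.Tactic.RingSolver as ℕRing
open import Tactic.RingSolver using (solve-∀)
open import Tactic.RingSolver.Core.AlmostCommutativeRing using (AlmostCommutativeRing; fromCommutativeRing)

-- No analysis enters: arcsin is only a coefficient sequence. Its linear equation is the recurrence
-- of the x_i read off degree by degree, and the quadratic equation is deduced from the linear one.
-- These two control every power because θ²(A^q) = q(q-1) A^(q-2) (θA)² + q A^(q-1) θ²A. Multiplying
-- by 1 - t² replaces (θA)² by t² and θ²A by θA, which leaves A^(q-2) and θ(A^q) only. The operator
-- θ is chosen over d/dt because it is diagonal on coefficients. The factor -4 compensates for the
-- half-integers: the arcsine recurrence carries (N+1)², the centred products carry -((N+1)/2)².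
-- Powers occur in the divided form y^k / k!. In that form the sum defining a Bell polynomial is a
-- multinomial expansion without coefficients, and the factorials recombine into the binomial
-- coefficient and (4n)!! only at the very end.

ℚ-acr : AlmostCommutativeRing 0ℓ 0ℓ
ℚ-acr = fromCommutativeRing ℚₚ.+-*-commutativeRing (λ p → dec⇒maybe (0ℚ ℚₚ.≟ p))

module ℚΣ = SemiringSum (CommutativeRing.semiring ℚₚ.+-*-commutativeRing)

-- Formal power series

0ₚ X : Poly
0ₚ _      = 0ℚ
X zero    = 0ℚ
X (suc n) = 1ₚ n

const : ℚ → Poly
const a zero    = a
const a (suc _) = 0ℚ

infixl 6 _+ₚ_
_+ₚ_ : Poly → Poly → Poly
(p +ₚ r) n = p n + r n

-ₚ_ : Poly → Poly
(-ₚ p) n = - p n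

-- The Euler operator t d/dt.
θ : Poly → Poly
θ p n = fromℕ n * p n

*ₚ-cong : ∀ {p p′ r r′} → p ≗ p′ → r ≗ r′ → p *ₚ r ≗ p′ *ₚ r′
*ₚ-cong p≗ r≗ n = ℚΣ.sum-cong-≗ {n = suc n} λ i → cong₂ _*_ (p≗ (toℕ i)) (r≗ (n ∸ toℕ i))

-- By computation a convolution unfolds only at the constant term of its left factor. This is the
-- mirror recursion at the constant term of the right factor; exchanging the factors turns one into
-- the other, which is the induction step of `*ₚ-comm`.
*ₚ-last : ∀ p r n → (p *ₚ r) (suc n) ≡ (p *ₚ (r ∘ suc)) n + p (suc n) * r 0
*ₚ-last p r zero    = lemma (p 0) (r 1) (p 1) (r 0)
  where
  lemma : ∀ a b c d → a * b + (c * d + 0ℚ) ≡ (a * b + 0ℚ) + c * d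
  lemma = solve-∀ ℚ-acr
*ₚ-last p r (suc n) = trans
  (cong (λ y → p 0 * r (suc (suc n)) + y) (*ₚ-last (p ∘ suc) r n))
  (sym (ℚₚ.+-assoc (p 0 * r (suc (suc n))) _ _))

*ₚ-comm : ∀ p r → p *ₚ r ≗ r *ₚ p
*ₚ-comm p r zero    = cong (_+ 0ℚ) (ℚₚ.*-comm (p 0) (r 0))
*ₚ-comm p r (suc n) = begin
  p 0 * r (suc n) + ((p ∘ suc) *ₚ r) n  ≡⟨ ℚₚ.+-comm (p 0 * r (suc n)) _ ⟩
  ((p ∘ suc) *ₚ r) n + p 0 * r (suc n)  ≡⟨ cong₂ _+_ (*ₚ-comm (p ∘ suc) r n) (ℚₚ.*-comm (p 0) (r (suc n))) ⟩
  (r *ₚ (p ∘ suc)) n + r (suc n) * p 0  ≡⟨ *ₚ-last r p n ⟨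
  (r *ₚ p) (suc n)                      ∎
  where open ≡-Reasoning

*ₚ-distribʳ : ∀ p q r → (q +ₚ r) *ₚ p ≗ (q *ₚ p) +ₚ (r *ₚ p)
*ₚ-distribʳ p q r n = trans
  (ℚΣ.sum-cong-≗ {n = suc n} λ i → ℚₚ.*-distribʳ-+ (p (n ∸ toℕ i)) (q (toℕ i)) (r (toℕ i)))
  (ℚΣ.∑-distrib-+ {n = suc n} (λ i → q (toℕ i) * p (n ∸ toℕ i)) (λ i → r (toℕ i) * p (n ∸ toℕ i)))

*ₚ-distribˡ : ∀ p q r → p *ₚ (q +ₚ r) ≗ (p *ₚ q) +ₚ (p *ₚ r)
*ₚ-distribˡ p q r n = begin
  (p *ₚ (q +ₚ r)) n          ≡⟨ *ₚ-comm p (q +ₚ r) n ⟩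
  ((q +ₚ r) *ₚ p) n          ≡⟨ *ₚ-distribʳ p q r n ⟩
  (q *ₚ p) n + (r *ₚ p) n    ≡⟨ cong₂ _+_ (*ₚ-comm q p n) (*ₚ-comm r p n) ⟩
  (p *ₚ q) n + (p *ₚ r) n    ∎
  where open ≡-Reasoning

scale-*ₚ : ∀ a p r n → ((λ i → a * p i) *ₚ r) n ≡ a * (p *ₚ r) n
scale-*ₚ a p r n = trans
  (ℚΣ.sum-cong-≗ {n = suc n} λ i → ℚₚ.*-assoc a (p (toℕ i)) (r (n ∸ toℕ i)))
  (sym (ℚΣ.*-distribˡ-sum {n = suc n} a (λ i → p (toℕ i) * r (n ∸ toℕ i))))

*ₚ-zeroˡ : ∀ p → 0ₚ *ₚ p ≗ 0ₚ
*ₚ-zeroˡ p zero    = cong (_+ 0ℚ) (ℚₚ.*-zeroˡ (p 0))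
*ₚ-zeroˡ p (suc n) = cong₂ _+_ (ℚₚ.*-zeroˡ (p (suc n))) (*ₚ-zeroˡ p n)

const-*ₚ : ∀ a p n → (const a *ₚ p) n ≡ a * p n
const-*ₚ a p zero    = ℚₚ.+-identityʳ (a * p 0)
const-*ₚ a p (suc n) = trans (cong (λ y → a * p (suc n) + y) (*ₚ-zeroˡ p n)) (ℚₚ.+-identityʳ _)

1ₚ≗const1 : 1ₚ ≗ const 1ℚ
1ₚ≗const1 zero    = refl
1ₚ≗const1 (suc n) = refl

*ₚ-identityˡ : ∀ p → 1ₚ *ₚ p ≗ p
*ₚ-identityˡ p n = begin
  (1ₚ *ₚ p) n         ≡⟨ *ₚ-cong {r = p} 1ₚ≗const1 (λ _ → refl) n ⟩
  (const 1ℚ *ₚ p) n   ≡⟨ const-*ₚ 1ℚ p n ⟩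
  1ℚ * p n            ≡⟨ ℚₚ.*-identityˡ (p n) ⟩
  p n                 ∎
  where open ≡-Reasoning

X-*ₚ : ∀ p n → (X *ₚ p) (suc n) ≡ p n
X-*ₚ p n = trans (cong₂ _+_ (ℚₚ.*-zeroˡ (p (suc n))) (*ₚ-identityˡ p n)) (ℚₚ.+-identityˡ (p n))

X-*ₚ-zero : ∀ p → (X *ₚ p) 0 ≡ 0ℚ
X-*ₚ-zero p = cong (_+ 0ℚ) (ℚₚ.*-zeroˡ (p 0))

*ₚ-assoc : ∀ p q r → (p *ₚ q) *ₚ r ≗ p *ₚ (q *ₚ r)
*ₚ-assoc p q r zero    = lemma (p 0) (q 0) (r 0)
  where
  lemma : ∀ a b c → (a * b + 0ℚ) * c + 0ℚ ≡ a * (b * c + 0ℚ) + 0ℚ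
  lemma = solve-∀ ℚ-acr
*ₚ-assoc p q r (suc n) = begin
  (p 0 * q 0 + 0ℚ) * r (suc n) + (((p *ₚ q) ∘ suc) *ₚ r) n
    ≡⟨ cong (λ y → (p 0 * q 0 + 0ℚ) * r (suc n) + y) (*ₚ-distribʳ r (λ i → p 0 * q (suc i)) ((p ∘ suc) *ₚ q) n) ⟩
  (p 0 * q 0 + 0ℚ) * r (suc n) + (((λ i → p 0 * q (suc i)) *ₚ r) n + (((p ∘ suc) *ₚ q) *ₚ r) n)
    ≡⟨ cong₂ (λ u v → (p 0 * q 0 + 0ℚ) * r (suc n) + (u + v)) (scale-*ₚ (p 0) (q ∘ suc) r n) (*ₚ-assoc (p ∘ suc) q r n) ⟩
  (p 0 * q 0 + 0ℚ) * r (suc n) + (p 0 * ((q ∘ suc) *ₚ r) n + ((p ∘ suc) *ₚ (q *ₚ r)) n)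
    ≡⟨ lemma (p 0) (q 0) (r (suc n)) (((q ∘ suc) *ₚ r) n) (((p ∘ suc) *ₚ (q *ₚ r)) n) ⟩
  p 0 * (q 0 * r (suc n) + ((q ∘ suc) *ₚ r) n) + ((p ∘ suc) *ₚ (q *ₚ r)) n
    ∎
  where
  open ≡-Reasoning
  lemma : ∀ a b c d e → (a * b + 0ℚ) * c + (a * d + e) ≡ a * (b * c + d) + e
  lemma = solve-∀ ℚ-acr

seriesRing : CommutativeRing 0ℓ 0ℓ
seriesRing = record
  { Carrier = Poly
  ; _≈_ = _≗_
  ; _+_ = _+ₚ_
  ; _*_ = _*ₚ_
  ; -_ = -ₚ_
  ; 0# = 0ₚ
  ; 1# = 1ₚ
  ; isCommutativeRing = record
    { isRing = record
      { +-isAbelianGroup = record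
        { isGroup = record
          { isMonoid = record
            { isSemigroup = record
              { isMagma = record
                { isEquivalence = record
                  { refl = λ _ → refl
                  ; sym = λ eq n → sym (eq n)
                  ; trans = λ eq eq′ n → trans (eq n) (eq′ n)
                  }
                ; ∙-cong = λ eq eq′ n → cong₂ _+_ (eq n) (eq′ n)
                }
              ; assoc = λ p q r n → ℚₚ.+-assoc (p n) (q n) (r n)
              }
            ; identity = (λ p n → ℚₚ.+-identityˡ (p n)) , (λ p n → ℚₚ.+-identityʳ (p n))
            }
          ; inverse = (λ p n → ℚₚ.+-inverseˡ (p n)) , (λ p n → ℚₚ.+-inverseʳ (p n))
          ; ⁻¹-cong = λ eq n → cong -_ (eq n)
          }
        ; comm = λ p q n → ℚₚ.+-comm (p n) (q n)
        }
      ; *-cong = *ₚ-cong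
      ; *-assoc = *ₚ-assoc
      ; *-identity = *ₚ-identityˡ , λ p n → trans (*ₚ-comm p 1ₚ n) (*ₚ-identityˡ p n)
      ; distrib = *ₚ-distribˡ , *ₚ-distribʳ
      }
    ; *-comm = *ₚ-comm
    }
  }

-- Natural numbers as rationals, and the Leibniz rule.

fromℕ-+ : ∀ m n → fromℕ (m ℕ.+ n) ≡ fromℕ m + fromℕ n
fromℕ-+ m n = ℚₚ.toℚᵘ-injective (begin
  -- `_/_` reduces fractions by a gcd that is stuck on variables, so the sum is computed on
  -- unnormalised fractions.
  toℚᵘ (fromℚᵘ (mkℚᵘ (+ (m ℕ.+ n)) 0))            ≈⟨ ℚₚ.toℚᵘ-fromℚᵘ (mkℚᵘ (+ (m ℕ.+ n)) 0) ⟩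
  mkℚᵘ (+ (m ℕ.+ n)) 0                            ≈⟨ *≡* (cong (ℤ._* + 1) (cong₂ ℤ._+_ (ℤₚ.*-identityʳ (+ m)) (ℤₚ.*-identityʳ (+ n)))) ⟨
  mkℚᵘ (+ m) 0 ℚᵘ.+ mkℚᵘ (+ n) 0                  ≈⟨ ℚᵘₚ.+-cong (ℚₚ.toℚᵘ-fromℚᵘ (mkℚᵘ (+ m) 0)) (ℚₚ.toℚᵘ-fromℚᵘ (mkℚᵘ (+ n) 0)) ⟨
  toℚᵘ (fromℕ m) ℚᵘ.+ toℚᵘ (fromℕ n)              ≈⟨ ℚₚ.toℚᵘ-homo-+ (fromℕ m) (fromℕ n) ⟨
  toℚᵘ (fromℕ m + fromℕ n)                        ∎)
  where open ℚᵘₚ.≃-Reasoning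

fromℕ-* : ∀ m n → fromℕ (m ℕ.* n) ≡ fromℕ m * fromℕ n
fromℕ-* m n = ℚₚ.toℚᵘ-injective (begin
  toℚᵘ (fromℚᵘ (mkℚᵘ (+ (m ℕ.* n)) 0))            ≈⟨ ℚₚ.toℚᵘ-fromℚᵘ (mkℚᵘ (+ (m ℕ.* n)) 0) ⟩
  mkℚᵘ (+ (m ℕ.* n)) 0                            ≈⟨ *≡* (cong (ℤ._* + 1) (ℤₚ.pos-* m n)) ⟩
  mkℚᵘ (+ m) 0 ℚᵘ.* mkℚᵘ (+ n) 0                  ≈⟨ ℚᵘₚ.*-cong (ℚₚ.toℚᵘ-fromℚᵘ (mkℚᵘ (+ m) 0)) (ℚₚ.toℚᵘ-fromℚᵘ (mkℚᵘ (+ n) 0)) ⟨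
  toℚᵘ (fromℕ m) ℚᵘ.* toℚᵘ (fromℕ n)              ≈⟨ ℚₚ.toℚᵘ-homo-* (fromℕ m) (fromℕ n) ⟨
  toℚᵘ (fromℕ m * fromℕ n)                        ∎)
  where open ℚᵘₚ.≃-Reasoning

/-*-cancel : ∀ a b .{{_ : NonZero b}} → (+ a / b) * fromℕ b ≡ fromℕ a
/-*-cancel a b@(suc b-1) = ℚₚ.toℚᵘ-injective (begin
  toℚᵘ ((+ a / b) * fromℕ b)                      ≈⟨ ℚₚ.toℚᵘ-homo-* (+ a / b) (fromℕ b) ⟩
  toℚᵘ (+ a / b) ℚᵘ.* toℚᵘ (fromℕ b)              ≈⟨ ℚᵘₚ.*-cong (ℚₚ.toℚᵘ-fromℚᵘ (mkℚᵘ (+ a) b-1)) (ℚₚ.toℚᵘ-fromℚᵘ (mkℚᵘ (+ b) 0)) ⟩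
  mkℚᵘ (+ a) b-1 ℚᵘ.* mkℚᵘ (+ b) 0                ≈⟨ *≡* (trans (ℤₚ.*-identityʳ _) (cong (λ y → + a ℤ.* + y) (sym (ℕₚ.*-identityʳ b)))) ⟩
  mkℚᵘ (+ a) 0                                    ≈⟨ ℚₚ.toℚᵘ-fromℚᵘ (mkℚᵘ (+ a) 0) ⟨
  toℚᵘ (fromℕ a)                                  ∎)
  where open ℚᵘₚ.≃-Reasoning

-- The means of clearing denominators: identities between quotients are reduced by it to identities
-- between products.
fromℕ-cancelʳ : ∀ n .{{_ : NonZero n}} {p q} → p * fromℕ n ≡ q * fromℕ n → p ≡ q
fromℕ-cancelʳ n {p} {q} eq = begin
  p                             ≡⟨ split p ⟩
  p * fromℕ n * (+ 1 / n)       ≡⟨ cong (_* (+ 1 / n)) eq ⟩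
  q * fromℕ n * (+ 1 / n)       ≡⟨ split q ⟨
  q                             ∎
  where
  open ≡-Reasoning
  lemma : ∀ a b c → a * (b * c) ≡ a * c * b
  lemma = solve-∀ ℚ-acr
  split : ∀ a → a ≡ a * fromℕ n * (+ 1 / n)
  split a = trans (sym (ℚₚ.*-identityʳ a)) (trans (cong (a *_) (sym (/-*-cancel 1 n))) (lemma a (+ 1 / n) (fromℕ n)))

-- The weight n of each summand of the convolution splits as i + (n - i), one part for each factor.
θ-*ₚ : ∀ p r → θ (p *ₚ r) ≗ (θ p *ₚ r) +ₚ (p *ₚ θ r)
θ-*ₚ p r n = begin
  fromℕ n * (p *ₚ r) n
    ≡⟨ ℚΣ.*-distribˡ-sum {n = suc n} (fromℕ n) (λ i → p (toℕ i) * r (n ∸ toℕ i)) ⟩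
  ∑[ i ≤ n ] (fromℕ n * (p (toℕ i) * r (n ∸ toℕ i)))
    ≡⟨ ℚΣ.sum-cong-≗ {n = suc n} (λ i → split (toℕ i) (ℕₚ.≤-pred (toℕ<n i))) ⟩
  ∑[ i ≤ n ] (θ p (toℕ i) * r (n ∸ toℕ i) + p (toℕ i) * θ r (n ∸ toℕ i))
    ≡⟨ ℚΣ.∑-distrib-+ {n = suc n} (λ i → θ p (toℕ i) * r (n ∸ toℕ i)) (λ i → p (toℕ i) * θ r (n ∸ toℕ i)) ⟩
  (θ p *ₚ r) n + (p *ₚ θ r) n
    ∎
  where
  open ≡-Reasoning
  lemma : ∀ a b c d → (a + b) * (c * d) ≡ a * c * d + c * (b * d)
  lemma = solve-∀ ℚ-acr
  split : ∀ i → i ≤ n → fromℕ n * (p i * r (n ∸ i)) ≡ θ p i * r (n ∸ i) + p i * θ r (n ∸ i)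
  split i i≤n = trans
    (cong (_* (p i * r (n ∸ i))) (trans (cong fromℕ (sym (ℕₚ.m+[n∸m]≡n i≤n))) (fromℕ-+ i (n ∸ i))))
    (lemma (fromℕ i) (fromℕ (n ∸ i)) (p i) (r (n ∸ i)))

nCk*k!*[n∸k]!≡n! : ∀ {n k} → k ≤ n → (n C k) ℕ.* (k ! ℕ.* (n ∸ k) !) ≡ n !
nCk*k!*[n∸k]!≡n! {n} {k} k≤n = trans
  (cong (ℕ._* (k ! ℕ.* (n ∸ k) !)) (nCk≡n!/k![n-k]! k≤n))
  (m/n*n≡m {{k ℕₚ.!* (n ∸ k) !≢0}} (k![n∸k]!∣n! k≤n))

-- Sums over lists.

module ListSum {c ℓ} (R : CommutativeSemiring c ℓ) where
  private module R = CommutativeSemiring R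
  open R using (Carrier; _≈_; 0#)
  open SemiringSum R.semiring using (sum)

  lsum : ∀ {A : Set} → (A → Carrier) → List A → Carrier
  lsum F xs = List.foldr R._+_ 0# (List.map F xs)

  lsum-cong : ∀ {A : Set} {F G : A → Carrier} → (∀ x → F x ≈ G x) → ∀ xs → lsum F xs ≈ lsum G xs
  lsum-cong eq []       = R.refl
  lsum-cong eq (x ∷ xs) = R.+-cong (eq x) (lsum-cong eq xs)

  lsum-zero : ∀ {A : Set} (xs : List A) → lsum (λ _ → 0#) xs ≈ 0#
  lsum-zero []       = R.refl
  lsum-zero (x ∷ xs) = R.trans (R.+-identityˡ _) (lsum-zero xs)

  lsum-*ˡ : ∀ {A : Set} a (F : A → Carrier) xs → lsum (λ x → a R.* F x) xs ≈ a R.* lsum F xs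
  lsum-*ˡ a F []       = R.sym (R.zeroʳ a)
  lsum-*ˡ a F (x ∷ xs) = R.trans (R.+-congˡ (lsum-*ˡ a F xs)) (R.sym (R.distribˡ a (F x) _))

  lsum-++ : ∀ {A : Set} (F : A → Carrier) xs ys → lsum F (xs ++ ys) ≈ lsum F xs R.+ lsum F ys
  lsum-++ F []       ys = R.sym (R.+-identityˡ _)
  lsum-++ F (x ∷ xs) ys = R.trans (R.+-congˡ (lsum-++ F xs ys)) (R.sym (R.+-assoc (F x) _ _))

  lsum-map : ∀ {A B : Set} (F : B → Carrier) (g : A → B) xs → lsum F (List.map g xs) ≈ lsum (F ∘ g) xs
  lsum-map F g []       = R.refl
  lsum-map F g (x ∷ xs) = R.+-congˡ (lsum-map F g xs)

  lsum-cartesianProductWith : ∀ {A B D : Set} (F : D → Carrier) (g : A → B → D) xs ys →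
    lsum F (cartesianProductWith g xs ys) ≈ lsum (λ x → lsum (F ∘ g x) ys) xs
  lsum-cartesianProductWith F g []       ys = R.refl
  lsum-cartesianProductWith F g (x ∷ xs) ys = R.trans
    (lsum-++ F (List.map (g x) ys) _)
    (R.+-cong (lsum-map F (g x) ys) (lsum-cartesianProductWith F g xs ys))

  lsum-applyUpTo : ∀ {A : Set} (F : A → Carrier) (f : ℕ → A) n →
    lsum F (applyUpTo f n) ≈ sum {n} (λ i → F (f (toℕ i)))
  lsum-applyUpTo F f zero    = R.refl
  lsum-applyUpTo F f (suc n) = R.+-congˡ (lsum-applyUpTo F (f ∘ suc) n)

  lsum-filter : ∀ {A : Set} {P : A → Set} (P? : Decidable P) (F : A → Carrier) xs →
    lsum F (filter P? xs) ≈ lsum (λ x → if does (P? x) then F x else 0#) xs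
  lsum-filter P? F []       = R.refl
  lsum-filter P? F (x ∷ xs) with does (P? x)
  ... | true  = R.+-congˡ (lsum-filter P? F xs)
  ... | false = R.trans (lsum-filter P? F xs) (R.sym (R.+-identityˡ _))

-- Divided powers and the multinomial theorem.

module SemiringPowers {c ℓ} (R : CommutativeSemiring c ℓ) where

  private module R = CommutativeSemiring R
  open R using (Carrier; _≈_; 0#; 1#) renaming (_*_ to _·_; _+_ to _∔_)
  open SemiringMult R.semiring using (_×_; ×-assoc-*; ×-congʳ; ×1-homo-*; ×-congˡ)
  open SemiringExp R using () renaming (_^_ to _↑_)
  private module Σ = SemiringSum R.semiring
  open Σ using (sum)
  open ListSum R
  open SemiringSolver R using (solve; _:*_; _:+_; _:=_; con)

  -- f n plays the role of 1/n!.
  module DividedPowers (f : ℕ → Carrier) (f-inverse : ∀ n → ((n !) × 1#) · f n ≈ 1#) where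

    -- The divided power y^n / n!. With this normalisation the binomial and multinomial theorems
    -- carry no coefficients, which matches the factor 1 / ∏ ℓ_i! of a Bell term.
    dpow : ℕ → Carrier → Carrier
    dpow n y = f n · y ↑ n

    dpow-zero : ∀ y → dpow 0 y ≈ 1#
    dpow-zero y = R.trans (R.*-identityʳ (f 0)) (R.trans (R.sym (R.*-identityˡ (f 0)))
      (R.trans (R.*-congʳ (R.sym (R.+-identityʳ 1#))) (f-inverse 0)))

    -- A semiring offers no cancellation. Instead the left side is multiplied by 1, written as k!
    -- `f k` times (n-k)! `f (n ∸ k)`; then C(n,k) k! (n-k)! = n! absorbs `f n`.
    f-binomial : ∀ {n k} → k ≤ n → ((n C k) × 1#) · f n ≈ f k · f (n ∸ k)
    f-binomial {n} {k} k≤n = begin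
      d · f n                                         ≈⟨ R.*-identityˡ _ ⟨
      1# · (d · f n)                                  ≈⟨ R.*-congʳ (R.*-identityˡ 1#) ⟨
      (1# · 1#) · (d · f n)                           ≈⟨ R.*-congʳ (R.*-cong (f-inverse k) (f-inverse (n ∸ k))) ⟨
      ((a · f k) · (b · f (n ∸ k))) · (d · f n)       ≈⟨ solve 6 (λ a b c u v w → ((a :* u) :* (b :* v)) :* (c :* w) := ((c :* (a :* b)) :* w) :* (u :* v)) R.refl a b d (f k) (f (n ∸ k)) (f n) ⟩
      ((d · (a · b)) · f n) · (f k · f (n ∸ k))       ≈⟨ R.*-congʳ (R.*-congʳ fact) ⟩
      (((n !) × 1#) · f n) · (f k · f (n ∸ k))          ≈⟨ R.*-congʳ (f-inverse n) ⟩
      1# · (f k · f (n ∸ k))                          ≈⟨ R.*-identityˡ _ ⟩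
      f k · f (n ∸ k)                                 ∎
      where
      open SetoidReasoning R.setoid
      a = (k !) × 1#
      b = ((n ∸ k) !) × 1#
      d = (n C k) × 1#
      fact : d · (a · b) ≈ (n !) × 1#
      fact = R.sym (R.trans (×-congˡ (sym (nCk*k!*[n∸k]!≡n! k≤n)))
        (R.trans (×1-homo-* (n C k) _) (R.*-congˡ (×1-homo-* (k !) ((n ∸ k) !)))))

    dpow-+ : ∀ n x y → dpow n (x R.+ y) ≈ sum {suc n} (λ i → dpow (toℕ i) x · dpow (n ∸ toℕ i) y)
    dpow-+ n x y = begin
      f n · (x R.+ y) ↑ n
        ≈⟨ R.*-congˡ (Binomial.theorem R n x y) ⟩
      f n · sum {suc n} (λ i → (n C toℕ i) × (x ↑ toℕ i · y ↑ (n ∸ toℕ i)))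
        ≈⟨ Σ.*-distribˡ-sum {suc n} (f n) (λ i → (n C toℕ i) × (x ↑ toℕ i · y ↑ (n ∸ toℕ i))) ⟩
      sum {suc n} (λ i → f n · ((n C toℕ i) × (x ↑ toℕ i · y ↑ (n ∸ toℕ i))))
        ≈⟨ Σ.sum-cong-≋ {suc n} (λ i → term (toℕ i) (ℕₚ.≤-pred (toℕ<n i))) ⟩
      sum {suc n} (λ i → dpow (toℕ i) x · dpow (n ∸ toℕ i) y)
        ∎
      where
      open SetoidReasoning R.setoid
      term : ∀ i → i ≤ n → f n · ((n C i) × (x ↑ i · y ↑ (n ∸ i))) ≈ dpow i x · dpow (n ∸ i) y
      term i i≤n = begin
        f n · ((n C i) × (x ↑ i · y ↑ (n ∸ i)))
          ≈⟨ R.*-congˡ (×-congʳ (n C i) (R.*-identityˡ _)) ⟨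
        f n · ((n C i) × (1# · (x ↑ i · y ↑ (n ∸ i))))
          ≈⟨ R.*-congˡ (×-assoc-* (n C i) 1# _) ⟨
        f n · (((n C i) × 1#) · (x ↑ i · y ↑ (n ∸ i)))
          ≈⟨ solve 4 (λ a b u v → a :* (b :* (u :* v)) := (b :* a) :* (u :* v)) R.refl (f n) ((n C i) × 1#) (x ↑ i) (y ↑ (n ∸ i)) ⟩
        (((n C i) × 1#) · f n) · (x ↑ i · y ↑ (n ∸ i))
          ≈⟨ R.*-congʳ (f-binomial i≤n) ⟩
        (f i · f (n ∸ i)) · (x ↑ i · y ↑ (n ∸ i))
          ≈⟨ solve 4 (λ a b u v → (a :* b) :* (u :* v) := (a :* u) :* (b :* v)) R.refl (f i) (f (n ∸ i)) (x ↑ i) (y ↑ (n ∸ i)) ⟩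
        dpow i x · dpow (n ∸ i) y
          ∎

    product : ∀ {N} → Vector Carrier N → Carrier
    product = Vector.foldr _·_ 1#

    -- `W i k` stands for a quantity that depends on k - i alone and vanishes for i > k. The three
    -- hypotheses say so without subtraction; hence a sum up to any bound b ≥ k stops at k.
    convolution-truncate : ∀ b k → k ≤ b → (a E : ℕ → Carrier) (W : ℕ → ℕ → Carrier) →
      (∀ j → j ≤ b → W 0 j ≈ E j) → (∀ i j → W (suc i) (suc j) ≈ W i j) → (∀ i → W (suc i) 0 ≈ 0#) →
      sum {suc b} (λ i → a (toℕ i) · W (toℕ i) k) ≈ sum {suc k} (λ i → a (toℕ i) · E (k ∸ toℕ i))
    convolution-truncate b zero k≤b a E W W0 W-suc W-zero = R.+-cong
      (R.*-congˡ (W0 0 z≤n))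
      (R.trans (Σ.sum-cong-≋ {b} {λ i → a (suc (toℕ i)) · W (suc (toℕ i)) 0} (λ i → R.trans (R.*-congˡ (W-zero (toℕ i))) (R.zeroʳ (a (suc (toℕ i)))))) (Σ.sum-replicate-zero b))
    convolution-truncate (suc b) (suc k) (s≤s k≤b) a E W W0 W-suc W-zero = R.+-cong
      (R.*-congˡ (W0 (suc k) (s≤s k≤b)))
      (R.trans (Σ.sum-cong-≋ {suc b} {λ i → a (suc (toℕ i)) · W (suc (toℕ i)) (suc k)} (λ i → R.*-congˡ (W-suc (toℕ i) k)))
        (convolution-truncate b k k≤b (a ∘ suc) E W (λ j j≤b → W0 j (ℕₚ.m≤n⇒m≤1+n j≤b)) W-suc W-zero))

    if-· : ∀ b a x → (if b then a · x else 0#) ≈ a · (if b then x else 0#)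
    if-· true  a x = R.refl
    if-· false a x = R.sym (R.zeroʳ a)

    -- Induction on the number of variables, splitting off the first by the binomial theorem
    -- `dpow-+`. The bound b on the entries is kept apart from k: the remaining entries have a
    -- smaller sum but are still listed up to the same b.
    multinomial : ∀ b {N} (y : Vector Carrier N) k → k ≤ b →
      lsum (λ ℓ → if ∑ℕ ℓ ≡ᵇ k then product (λ i → dpow (ℓ i) (y i)) else 0#) (tuples b N) ≈ dpow k (sum y)
    multinomial b {zero} y zero k≤b = R.trans (R.+-identityʳ 1#) (R.sym (dpow-zero (sum y)))
    multinomial b {zero} y (suc k) k≤b = R.trans (R.+-identityʳ 0#)
      (R.sym (R.trans (R.*-congˡ (R.zeroˡ _)) (R.zeroʳ _)))
    multinomial b {suc N} y k k≤b = begin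
      lsum F (tuples b (suc N))
        ≈⟨ lsum-cartesianProductWith F Vector._∷_ (upTo (suc b)) (tuples b N) ⟩
      lsum (λ j → lsum (λ ℓ → F (j Vector.∷ ℓ)) (tuples b N)) (upTo (suc b))
        ≈⟨ lsum-applyUpTo _ (λ j → j) (suc b) ⟩
      sum {suc b} (λ j → lsum (λ ℓ → F (toℕ j Vector.∷ ℓ)) (tuples b N))
        ≈⟨ Σ.sum-cong-≋ {suc b} (λ j → split (toℕ j)) ⟩
      sum {suc b} (λ j → dpow (toℕ j) (y zero) · W (toℕ j) k)
        -- The last two hypotheses rest on how `≡ᵇ` computes: a successor on both sides cancels, and
        -- a successor against 0 gives false.
        ≈⟨ convolution-truncate b k k≤b (λ j → dpow j (y zero)) (λ j → dpow j (sum (y ∘ suc))) W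
             (multinomial b (y ∘ suc)) (λ _ _ → R.refl) (λ _ → lsum-zero (tuples b N)) ⟩
      sum {suc k} (λ j → dpow (toℕ j) (y zero) · dpow (k ∸ toℕ j) (sum (y ∘ suc)))
        ≈⟨ dpow-+ k (y zero) (sum (y ∘ suc)) ⟨
      dpow k (sum y)
        ∎
      where
      open SetoidReasoning R.setoid
      F : Vector ℕ (suc N) → Carrier
      F ℓ = if ∑ℕ ℓ ≡ᵇ k then product (λ i → dpow (ℓ i) (y i)) else 0#
      W : ℕ → ℕ → Carrier
      W j k′ = lsum (λ ℓ → if (j ℕ.+ ∑ℕ ℓ) ≡ᵇ k′ then product (λ i → dpow (ℓ i) (y (suc i))) else 0#) (tuples b N)
      split : ∀ j → lsum (λ ℓ → F (j Vector.∷ ℓ)) (tuples b N) ≈ dpow j (y zero) · W j k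
      split j = R.trans
        (lsum-cong (λ ℓ → if-· ((j ℕ.+ ∑ℕ ℓ) ≡ᵇ k) (dpow j (y zero)) _) (tuples b N))
        (lsum-*ˡ (dpow j (y zero)) _ (tuples b N))

  -- The second-order equation satisfied by the powers of a solution.

  module PowerODE
    (θ : Carrier → Carrier)
    (θ-cong : ∀ {x y} → x ≈ y → θ x ≈ θ y)
    (θ-0 : θ 0# ≈ 0#)
    (θ-1 : θ 1# ≈ 0#)
    (θ-+ : ∀ x y → θ (x ∔ y) ≈ θ x ∔ θ y)
    (θ-* : ∀ x y → θ (x · y) ≈ θ x · y ∔ x · θ y)
    (A E T : Carrier)
    (linear : E · θ (θ A) ≈ θ A)
    (quadratic : E · (θ A · θ A) ≈ T)
    where

    open SetoidReasoning R.setoid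

    -- q A^(q-1) and q (q-1) A^(q-2), by recursions that make sense for all q.
    G H : ℕ → Carrier
    G zero    = 0#
    G (suc q) = A ↑ q ∔ A · G q
    H zero    = 0#
    H (suc q) = (G q ∔ G q) ∔ A · H q

    G-suc : ∀ q → G (suc q) ≈ (suc q × 1#) · A ↑ q
    G-suc zero    = solve 1 (λ a → con 1 :+ a :* con 0 := (con 1 :+ con 0) :* con 1) R.refl A
    G-suc (suc q) = R.trans (R.+-congˡ (R.*-congˡ (G-suc q)))
      (solve 3 (λ a p n → a :* p :+ a :* (n :* p) := (con 1 :+ n) :* (a :* p)) R.refl A (A ↑ q) (suc q × 1#))

    H-one : H 1 ≈ 0#
    H-one = solve 1 (λ a → (con 0 :+ con 0) :+ a :* con 0 := con 0) R.refl A

    H-suc-suc : ∀ q → H (suc (suc q)) ≈ ((suc (suc q) × 1#) · (suc q × 1#)) · A ↑ q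
    H-suc-suc zero    = solve 1
      (λ a → ((con 1 :+ a :* con 0) :+ (con 1 :+ a :* con 0)) :+ a :* ((con 0 :+ con 0) :+ a :* con 0)
               := ((con 1 :+ (con 1 :+ con 0)) :* (con 1 :+ con 0)) :* con 1) R.refl A
    H-suc-suc (suc q) = R.trans
      (R.+-cong (R.+-cong (G-suc (suc q)) (G-suc (suc q))) (R.*-congˡ (H-suc-suc q)))
      (solve 3 (λ a p n →
          ((con 1 :+ (con 1 :+ n)) :* (a :* p) :+ (con 1 :+ (con 1 :+ n)) :* (a :* p)) :+ a :* (((con 1 :+ (con 1 :+ n)) :* (con 1 :+ n)) :* p)
            := ((con 1 :+ (con 1 :+ (con 1 :+ n))) :* (con 1 :+ (con 1 :+ n))) :* (a :* p)) R.refl A (A ↑ q) (q × 1#))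

    θ-power : ∀ q → θ (A ↑ q) ≈ G q · θ A
    θ-power zero    = R.trans θ-1 (R.sym (R.zeroˡ _))
    θ-power (suc q) = begin
      θ (A · A ↑ q)                         ≈⟨ θ-* A (A ↑ q) ⟩
      θ A · A ↑ q ∔ A · θ (A ↑ q)           ≈⟨ R.+-congˡ (R.*-congˡ (θ-power q)) ⟩
      θ A · A ↑ q ∔ A · (G q · θ A)         ≈⟨ solve 4 (λ a p g t → t :* p :+ a :* (g :* t) := (p :+ a :* g) :* t) R.refl A (A ↑ q) (G q) (θ A) ⟩
      (A ↑ q ∔ A · G q) · θ A               ∎

    -- Of the two terms of θ²(A^q), the one with (θA)² becomes `H q · T` by `quadratic`, and the one
    -- with θ²A becomes q A^(q-1) θA = θ(A^q) by `linear`. The application has A = arcsin, E = 1 -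
    -- t² and T = t².
    θθ-power : ∀ q → E · θ (θ (A ↑ q)) ≈ H q · T ∔ θ (A ↑ q)
    θθ-power zero    = begin
      E · θ (θ 1#)      ≈⟨ R.*-congˡ (R.trans (θ-cong θ-1) θ-0) ⟩
      E · 0#            ≈⟨ solve 2 (λ e t → e :* con 0 := con 0 :* t :+ con 0) R.refl E T ⟩
      0# · T ∔ 0#       ≈⟨ R.+-congˡ θ-1 ⟨
      0# · T ∔ θ 1#     ∎
    θθ-power (suc q) = begin
      E · θ (θ (A · p))
        ≈⟨ R.*-congˡ (R.trans (θ-cong (θ-* A p)) (R.trans (θ-+ _ _) (R.+-cong (θ-* (θ A) p) (θ-* A (θ p))))) ⟩
      E · ((θ (θ A) · p ∔ θ A · θ p) ∔ (θ A · θ p ∔ A · θ (θ p)))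
        ≈⟨ R.*-congˡ (R.+-cong (R.+-congˡ (R.*-congˡ (θ-power q))) (R.+-congʳ (R.*-congˡ (θ-power q)))) ⟩
      E · ((θ (θ A) · p ∔ θ A · (G q · θ A)) ∔ (θ A · (G q · θ A) ∔ A · θ (θ p)))
        ≈⟨ solve 7 (λ e u p t g a s →
              e :* ((u :* p :+ t :* (g :* t)) :+ (t :* (g :* t) :+ a :* s))
                := ((e :* u) :* p :+ a :* (e :* s)) :+ (g :+ g) :* (e :* (t :* t)))
             R.refl E (θ (θ A)) p (θ A) (G q) A (θ (θ p)) ⟩
      ((E · θ (θ A)) · p ∔ A · (E · θ (θ p))) ∔ (G q ∔ G q) · (E · (θ A · θ A))
        ≈⟨ R.+-cong (R.+-cong (R.*-congʳ linear) (R.*-congˡ (θθ-power q))) (R.*-congˡ quadratic) ⟩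
      (θ A · p ∔ A · (H q · T ∔ θ p)) ∔ (G q ∔ G q) · T
        ≈⟨ solve 7 (λ t p a h u s g →
              (t :* p :+ a :* (h :* u :+ s)) :+ (g :+ g) :* u := ((g :+ g) :+ a :* h) :* u :+ (t :* p :+ a :* s))
             R.refl (θ A) p A (H q) T (θ p) (G q) ⟩
      H (suc q) · T ∔ (θ A · p ∔ A · θ p)
        ≈⟨ R.+-congˡ (θ-* A p) ⟨
      H (suc q) · T ∔ θ (A · p)
        ∎
      where p = A ↑ q

-- Specialisation to rationals and to power series.

seriesSemiring : CommutativeSemiring 0ℓ 0ℓ
seriesSemiring = CommutativeRing.commutativeSemiring seriesRing

ℚ-semiring : CommutativeSemiring 0ℓ 0ℓ
ℚ-semiring = CommutativeRing.commutativeSemiring ℚₚ.+-*-commutativeRing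

module S = CommutativeSemiring seriesSemiring
module SΣ = SemiringSum S.semiring
module SL = ListSum seriesSemiring
module ℚL = ListSum ℚ-semiring
module ℚ^ = SemiringExp ℚ-semiring
open SemiringExp seriesSemiring using () renaming (_^_ to _^ₚ_)
module S^ = SemiringExp seriesSemiring
open SemiringMult S.semiring using () renaming (_×_ to _×ₚ_)
open SemiringMult (CommutativeSemiring.semiring ℚ-semiring) using () renaming (_×_ to _×ℚ_)

×ₚ-coeff : ∀ n p m → (n ×ₚ p) m ≡ fromℕ n * p m
×ₚ-coeff zero    p m = sym (ℚₚ.*-zeroˡ (p m))
×ₚ-coeff (suc n) p m = begin
  p m + (n ×ₚ p) m          ≡⟨ cong (λ y → p m + y) (×ₚ-coeff n p m) ⟩
  p m + fromℕ n * p m       ≡⟨ lemma (p m) (fromℕ n) ⟩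
  (1ℚ + fromℕ n) * p m      ≡⟨ cong (_* p m) (fromℕ-+ 1 n) ⟨
  fromℕ (suc n) * p m       ∎
  where
  open ≡-Reasoning
  lemma : ∀ a b → a + b * a ≡ (1ℚ + b) * a
  lemma = solve-∀ ℚ-acr

×ℚ-1 : ∀ n → n ×ℚ 1ℚ ≡ fromℕ n
×ℚ-1 zero    = refl
×ℚ-1 (suc n) = trans (cong (λ t → 1ℚ + t) (×ℚ-1 n)) (sym (fromℕ-+ 1 n))

!-inverse : ∀ n → fromℕ (n !) * (1 /! n) ≡ 1ℚ
!-inverse n = trans (ℚₚ.*-comm (fromℕ (n !)) (1 /! n)) (/-*-cancel 1 (n !) {{n ℕₚ.!≢0}})

/!≡*1/! : ∀ a n → a /! n ≡ fromℕ a * (1 /! n)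
/!≡*1/! a n = fromℕ-cancelʳ (n !) {{n ℕₚ.!≢0}} (begin
  (a /! n) * fromℕ (n !)              ≡⟨ /-*-cancel a (n !) {{n ℕₚ.!≢0}} ⟩
  fromℕ a                             ≡⟨ ℚₚ.*-identityʳ (fromℕ a) ⟨
  fromℕ a * 1ℚ                        ≡⟨ cong (fromℕ a *_) (/-*-cancel 1 (n !) {{n ℕₚ.!≢0}}) ⟨
  fromℕ a * ((1 /! n) * fromℕ (n !))  ≡⟨ ℚₚ.*-assoc (fromℕ a) (1 /! n) (fromℕ (n !)) ⟨
  fromℕ a * (1 /! n) * fromℕ (n !)    ∎)
  where open ≡-Reasoning

×ℚ-!-inverse : ∀ n → ((n !) ×ℚ 1ℚ) * (1 /! n) ≡ 1ℚ
×ℚ-!-inverse n = trans (cong (_* (1 /! n)) (×ℚ-1 (n !))) (!-inverse n)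

module ℚD = SemiringPowers.DividedPowers ℚ-semiring (1 /!_) ×ℚ-!-inverse

1/!-binomial : ∀ {n k} → k ≤ n → fromℕ (n C k) * (1 /! n) ≡ (1 /! k) * (1 /! (n ∸ k))
1/!-binomial {n} {k} k≤n = trans (cong (_* (1 /! n)) (sym (×ℚ-1 (n C k)))) (ℚD.f-binomial k≤n)

const-1/! : ℕ → Poly
const-1/! n = const (1 /! n)

const-1/!-inverse : ∀ n → ((n !) ×ₚ 1ₚ) *ₚ const-1/! n ≗ 1ₚ
const-1/!-inverse n m = begin
  (((n !) ×ₚ 1ₚ) *ₚ const (1 /! n)) m      ≡⟨ *ₚ-comm ((n !) ×ₚ 1ₚ) (const (1 /! n)) m ⟩
  (const (1 /! n) *ₚ ((n !) ×ₚ 1ₚ)) m      ≡⟨ const-*ₚ (1 /! n) ((n !) ×ₚ 1ₚ) m ⟩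
  (1 /! n) * ((n !) ×ₚ 1ₚ) m               ≡⟨ cong ((1 /! n) *_) (×ₚ-coeff (n !) 1ₚ m) ⟩
  (1 /! n) * (fromℕ (n !) * 1ₚ m)          ≡⟨ lemma (1 /! n) (fromℕ (n !)) (1ₚ m) ⟩
  fromℕ (n !) * (1 /! n) * 1ₚ m            ≡⟨ cong (_* 1ₚ m) (!-inverse n) ⟩
  1ℚ * 1ₚ m                                ≡⟨ ℚₚ.*-identityˡ (1ₚ m) ⟩
  1ₚ m                                     ∎
  where
  open ≡-Reasoning
  lemma : ∀ a b c → a * (b * c) ≡ b * a * c
  lemma = solve-∀ ℚ-acr

module SD = SemiringPowers.DividedPowers seriesSemiring const-1/! const-1/!-inverse
open SD using (dpow)

const-* : ∀ a b → const (a * b) ≗ const a *ₚ const b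
const-* a b zero    = sym (const-*ₚ a (const b) 0)
const-* a b (suc n) = sym (trans (const-*ₚ a (const b) (suc n)) (ℚₚ.*-zeroʳ a))

const-^ : ∀ a n → const a ^ₚ n ≗ const (a ^ n)
const-^ a zero    m = 1ₚ≗const1 m
const-^ a (suc n) m = trans
  (*ₚ-cong {const a} {const a} (λ _ → refl) (const-^ a n) m)
  (sym (const-* a (a ^ n) m))

X^-*ₚ : ∀ k p n → ((X ^ₚ k) *ₚ p) (k ℕ.+ n) ≡ p n
X^-*ₚ zero    p n = *ₚ-identityˡ p n
X^-*ₚ (suc k) p n = begin
  ((X *ₚ (X ^ₚ k)) *ₚ p) (suc (k ℕ.+ n))   ≡⟨ *ₚ-assoc X (X ^ₚ k) p (suc (k ℕ.+ n)) ⟩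
  (X *ₚ ((X ^ₚ k) *ₚ p)) (suc (k ℕ.+ n))   ≡⟨ X-*ₚ ((X ^ₚ k) *ₚ p) (k ℕ.+ n) ⟩
  ((X ^ₚ k) *ₚ p) (k ℕ.+ n)                ≡⟨ X^-*ₚ k p n ⟩
  p n                                      ∎
  where open ≡-Reasoning

X^-coeff : ∀ m n → (X ^ₚ m) n ≡ (if m ≡ᵇ n then 1ℚ else 0ℚ)
X^-coeff zero    zero    = refl
X^-coeff zero    (suc n) = refl
X^-coeff (suc m) zero    = X-*ₚ-zero (X ^ₚ m)
X^-coeff (suc m) (suc n) = trans (X-*ₚ (X ^ₚ m) n) (X^-coeff m n)

sum-coeff : ∀ {N} (y : Vector Poly N) m → SΣ.sum y m ≡ ∑[ i < N ] y i m
sum-coeff {zero}  y m = refl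
sum-coeff {suc N} y m = cong (λ z → y zero m + z) (sum-coeff (y ∘ suc) m)

lsum-coeff : ∀ {A : Set} (F : A → Poly) xs m → SL.lsum F xs m ≡ ℚL.lsum (λ z → F z m) xs
lsum-coeff F []       m = refl
lsum-coeff F (z ∷ xs) m = cong (λ t → F z m + t) (lsum-coeff F xs m)


-- Partial Bell polynomials as coefficients of powers

dpow-monomial : ∀ j g w → dpow j (const g *ₚ (X ^ₚ w)) ≗ const ((1 /! j) * g ^ j) *ₚ (X ^ₚ (w ℕ.* j))
dpow-monomial j g w = begin
  const (1 /! j) *ₚ ((const g *ₚ (X ^ₚ w)) ^ₚ j)
    ≈⟨ S.*-congˡ {const (1 /! j)} (S^.^-distrib-* (const g) (X ^ₚ w) j) ⟩
  const (1 /! j) *ₚ ((const g ^ₚ j) *ₚ ((X ^ₚ w) ^ₚ j))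
    ≈⟨ S.*-congˡ {const (1 /! j)} (S.*-cong (const-^ g j) (S^.^-assocʳ X w j)) ⟩
  const (1 /! j) *ₚ (const (g ^ j) *ₚ (X ^ₚ (w ℕ.* j)))
    ≈⟨ S.*-assoc (const (1 /! j)) (const (g ^ j)) (X ^ₚ (w ℕ.* j)) ⟨
  (const (1 /! j) *ₚ const (g ^ j)) *ₚ (X ^ₚ (w ℕ.* j))
    ≈⟨ S.*-congʳ {X ^ₚ (w ℕ.* j)} (const-* (1 /! j) (g ^ j)) ⟨
  const ((1 /! j) * g ^ j) *ₚ (X ^ₚ (w ℕ.* j))
    ∎
  where open SetoidReasoning S.setoid

-- The exponents `w` are arbitrary, although only w_i = i is used, because passing to the tail of
-- the vector shifts them.
product-dpow-monomial : ∀ {N} (ℓ w : Vector ℕ N) (g : Vector ℚ N) →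
  SD.product (λ i → dpow (ℓ i) (const (g i) *ₚ (X ^ₚ w i)))
    ≗ const (∏ℚ (λ i → (1 /! ℓ i) * g i ^ ℓ i)) *ₚ (X ^ₚ ∑ℕ (λ i → w i ℕ.* ℓ i))
product-dpow-monomial {zero}  ℓ w g n = sym (trans (const-*ₚ 1ℚ 1ₚ n) (ℚₚ.*-identityˡ (1ₚ n)))
product-dpow-monomial {suc N} ℓ w g = begin
  dpow (ℓ zero) (const (g zero) *ₚ (X ^ₚ w zero)) *ₚ SD.product (λ i → dpow (ℓ (suc i)) (const (g (suc i)) *ₚ (X ^ₚ w (suc i))))
    ≈⟨ S.*-cong (dpow-monomial (ℓ zero) (g zero) (w zero)) (product-dpow-monomial (ℓ ∘ suc) (w ∘ suc) (g ∘ suc)) ⟩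
  (const c₀ *ₚ (X ^ₚ e₀)) *ₚ (const c₁ *ₚ (X ^ₚ e₁))
    ≈⟨ solve 4 (λ a b c d → (a :* b) :* (c :* d) := (a :* c) :* (b :* d)) S.refl (const c₀) (X ^ₚ e₀) (const c₁) (X ^ₚ e₁) ⟩
  (const c₀ *ₚ const c₁) *ₚ ((X ^ₚ e₀) *ₚ (X ^ₚ e₁))
    ≈⟨ S.*-cong (const-* c₀ c₁) (S^.^-homo-* X e₀ e₁) ⟨
  const (c₀ * c₁) *ₚ (X ^ₚ (e₀ ℕ.+ e₁))
    ∎
  where
  open SetoidReasoning S.setoid
  open SemiringSolver seriesSemiring using (solve; _:*_; _:=_)
  c₀ c₁ : ℚ
  c₀ = (1 /! ℓ zero) * g zero ^ ℓ zero
  c₁ = ∏ℚ (λ i → (1 /! ℓ (suc i)) * g (suc i) ^ ℓ (suc i))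
  e₀ e₁ : ℕ
  e₀ = w zero ℕ.* ℓ zero
  e₁ = ∑ℕ (λ i → w (suc i) ℕ.* ℓ (suc i))

∏1/!-inverse : ∀ {N} (ℓ : Vector ℕ N) → ∏ℚ (λ i → 1 /! ℓ i) * fromℕ (∏ℕ (_! ∘ ℓ)) ≡ 1ℚ
∏1/!-inverse {zero}  ℓ = refl
∏1/!-inverse {suc N} ℓ = begin
  (a * b) * fromℕ (ℓ zero ! ℕ.* d)      ≡⟨ cong ((a * b) *_) (fromℕ-* (ℓ zero !) d) ⟩
  (a * b) * (fromℕ (ℓ zero !) * fromℕ d) ≡⟨ lemma a b (fromℕ (ℓ zero !)) (fromℕ d) ⟩
  (fromℕ (ℓ zero !) * a) * (b * fromℕ d) ≡⟨ cong₂ _*_ (!-inverse (ℓ zero)) (∏1/!-inverse (ℓ ∘ suc)) ⟩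
  1ℚ                                     ∎
  where
  open ≡-Reasoning
  a b : ℚ
  a = 1 /! ℓ zero
  b = ∏ℚ (λ i → 1 /! ℓ (suc i))
  d = ∏ℕ (λ i → ℓ (suc i) !)
  lemma : ∀ a b c d → (a * b) * (c * d) ≡ (c * a) * (b * d)
  lemma = solve-∀ ℚ-acr

∏ℚ-* : ∀ {N} (a b : Vector ℚ N) → ∏ℚ (λ i → a i * b i) ≡ ∏ℚ a * ∏ℚ b
∏ℚ-* {zero}  a b = refl
∏ℚ-* {suc N} a b = trans
  (cong (λ t → a zero * b zero * t) (∏ℚ-* (a ∘ suc) (b ∘ suc)))
  (lemma (a zero) (b zero) (∏ℚ (a ∘ suc)) (∏ℚ (b ∘ suc)))
  where
  lemma : ∀ a b c d → a * b * (c * d) ≡ a * c * (b * d)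
  lemma = solve-∀ ℚ-acr

bellTerm-∏ : ∀ n {N} (v : Vector ℚ N) ℓ →
  bellTerm n v ℓ ≡ fromℕ (n !) * ∏ℚ (λ i → (1 /! ℓ i) * (v i * (1 /! suc (toℕ i))) ^ ℓ i)
bellTerm-∏ n v ℓ = begin
  (+ (n !) / d) {{d≢0}} * P                    ≡⟨ cong (_* P) quotient ⟩
  fromℕ (n !) * ∏ℚ (λ i → 1 /! ℓ i) * P        ≡⟨ ℚₚ.*-assoc (fromℕ (n !)) (∏ℚ (λ i → 1 /! ℓ i)) P ⟩
  fromℕ (n !) * (∏ℚ (λ i → 1 /! ℓ i) * P)      ≡⟨ cong (fromℕ (n !) *_) (∏ℚ-* (λ i → 1 /! ℓ i) (λ i → (v i * (1 /! suc (toℕ i))) ^ ℓ i)) ⟨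
  _                                            ∎
  where
  open ≡-Reasoning
  d = ∏ℕ (_! ∘ ℓ)
  d≢0 = ∏!≢0 ℓ
  P : ℚ
  P = ∏ℚ (λ i → (v i * (1 /! suc (toℕ i))) ^ ℓ i)
  quotient : (+ (n !) / d) {{d≢0}} ≡ fromℕ (n !) * ∏ℚ (λ i → 1 /! ℓ i)
  quotient = fromℕ-cancelʳ d {{d≢0}} (begin
    (+ (n !) / d) {{d≢0}} * fromℕ d                  ≡⟨ /-*-cancel (n !) d {{d≢0}} ⟩
    fromℕ (n !)                                      ≡⟨ ℚₚ.*-identityʳ (fromℕ (n !)) ⟨
    fromℕ (n !) * 1ℚ                                 ≡⟨ cong (fromℕ (n !) *_) (∏1/!-inverse ℓ) ⟨
    fromℕ (n !) * (∏ℚ (λ i → 1 /! ℓ i) * fromℕ d)    ≡⟨ ℚₚ.*-assoc (fromℕ (n !)) (∏ℚ (λ i → 1 /! ℓ i)) (fromℕ d) ⟨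
    fromℕ (n !) * ∏ℚ (λ i → 1 /! ℓ i) * fromℕ d      ∎)


bellMonomial : ∀ {N} → Vector ℚ N → Vector Poly N
bellMonomial v i = const (v i * (1 /! suc (toℕ i))) *ₚ (X ^ₚ suc (toℕ i))

bellSeries : ∀ {N} → Vector ℚ N → Poly
bellSeries v = SΣ.sum (bellMonomial v)

-- Expanding the divided power of ∑ x_i t^i / i! by `multinomial` produces the condition ∑ ℓ_i = k.
-- The condition ∑ i ℓ_i = n is the extraction of the coefficient of t^n, since the term of ℓ is a
-- multiple of t^(∑ i ℓ_i).
bell-coefficient : ∀ n k v → bell n k v ≡ fromℕ (n !) * dpow k (bellSeries v) n
bell-coefficient n k v = begin
  ℚL.lsum (bellTerm n v) (filter (isBellIndex? n k) T)
    ≡⟨ ℚL.lsum-filter (isBellIndex? n k) (bellTerm n v) T ⟩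
  ℚL.lsum (λ ℓ → if does (isBellIndex? n k ℓ) then bellTerm n v ℓ else 0ℚ) T
    ≡⟨ ℚL.lsum-cong term T ⟩
  ℚL.lsum (λ ℓ → fromℕ (n !) * M ℓ n) T
    ≡⟨ ℚL.lsum-*ˡ (fromℕ (n !)) (λ ℓ → M ℓ n) T ⟩
  fromℕ (n !) * ℚL.lsum (λ ℓ → M ℓ n) T
    ≡⟨ cong (fromℕ (n !) *_) (lsum-coeff M T n) ⟨
  fromℕ (n !) * SL.lsum M T n
    ≡⟨ cong (fromℕ (n !) *_) (SD.multinomial k y k ℕₚ.≤-refl n) ⟩
  fromℕ (n !) * dpow k (bellSeries v) n
    ∎
  where
  open ≡-Reasoning
  N = suc (n ∸ k)
  T = tuples k N
  g : Vector ℚ N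
  g i = v i * (1 /! suc (toℕ i))
  y : Vector Poly N
  y = bellMonomial v
  M : Vector ℕ N → Poly
  M ℓ = if ∑ℕ ℓ ≡ᵇ k then SD.product (λ i → dpow (ℓ i) (y i)) else 0ₚ
  P : Vector ℕ N → ℚ
  P ℓ = ∏ℚ (λ i → (1 /! ℓ i) * g i ^ ℓ i)
  if-∧ : ∀ b c {t : ℚ} → (if b ∧ c then t else 0ℚ) ≡ (if c then (if b then t else 0ℚ) else 0ℚ)
  if-∧ true  c     = refl
  if-∧ false true  = refl
  if-∧ false false = refl
  if-* : ∀ b a c → (if b then a * c else 0ℚ) ≡ a * (c * (if b then 1ℚ else 0ℚ))
  if-* true  a c = cong (a *_) (sym (ℚₚ.*-identityʳ c))
  if-* false a c = sym (trans (cong (a *_) (ℚₚ.*-zeroʳ c)) (ℚₚ.*-zeroʳ a))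
  if-coeff : ∀ b a p → (if b then a * p n else 0ℚ) ≡ a * (if b then p else 0ₚ) n
  if-coeff true  a p = refl
  if-coeff false a p = sym (ℚₚ.*-zeroʳ a)
  weight : Vector ℕ N → ℕ
  weight ℓ = ∑ℕ (λ i → suc (toℕ i) ℕ.* ℓ i)
  monomial : ∀ ℓ → (if weight ℓ ≡ᵇ n then bellTerm n v ℓ else 0ℚ) ≡ fromℕ (n !) * SD.product (λ i → dpow (ℓ i) (y i)) n
  monomial ℓ = begin
    (if weight ℓ ≡ᵇ n then bellTerm n v ℓ else 0ℚ)
      ≡⟨ cong (λ t → if weight ℓ ≡ᵇ n then t else 0ℚ) (bellTerm-∏ n v ℓ) ⟩
    (if weight ℓ ≡ᵇ n then fromℕ (n !) * P ℓ else 0ℚ)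
      ≡⟨ if-* (weight ℓ ≡ᵇ n) (fromℕ (n !)) (P ℓ) ⟩
    fromℕ (n !) * (P ℓ * (if weight ℓ ≡ᵇ n then 1ℚ else 0ℚ))
      ≡⟨ cong (λ t → fromℕ (n !) * (P ℓ * t)) (X^-coeff (weight ℓ) n) ⟨
    fromℕ (n !) * (P ℓ * (X ^ₚ weight ℓ) n)
      ≡⟨ cong (fromℕ (n !) *_) (const-*ₚ (P ℓ) (X ^ₚ weight ℓ) n) ⟨
    fromℕ (n !) * (const (P ℓ) *ₚ (X ^ₚ weight ℓ)) n
      ≡⟨ cong (fromℕ (n !) *_) (product-dpow-monomial ℓ (λ i → suc (toℕ i)) g n) ⟨
    fromℕ (n !) * SD.product (λ i → dpow (ℓ i) (y i)) n
      ∎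
  term : ∀ ℓ → (if does (isBellIndex? n k ℓ) then bellTerm n v ℓ else 0ℚ) ≡ fromℕ (n !) * M ℓ n
  term ℓ = begin
    -- The `does` field of the decision procedure computes to this conjunction of Boolean tests.
    (if (weight ℓ ≡ᵇ n) ∧ (∑ℕ ℓ ≡ᵇ k) then bellTerm n v ℓ else 0ℚ)
      ≡⟨ if-∧ (weight ℓ ≡ᵇ n) (∑ℕ ℓ ≡ᵇ k) ⟩
    (if ∑ℕ ℓ ≡ᵇ k then (if weight ℓ ≡ᵇ n then bellTerm n v ℓ else 0ℚ) else 0ℚ)
      ≡⟨ cong (λ t → if ∑ℕ ℓ ≡ᵇ k then t else 0ℚ) (monomial ℓ) ⟩
    (if ∑ℕ ℓ ≡ᵇ k then fromℕ (n !) * SD.product (λ i → dpow (ℓ i) (y i)) n else 0ℚ)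
      ≡⟨ if-coeff (∑ℕ ℓ ≡ᵇ k) (fromℕ (n !)) (SD.product (λ i → dpow (ℓ i) (y i))) ⟩
    fromℕ (n !) * M ℓ n
      ∎

∑X^-coeff : ∀ N (h : ℕ → ℚ) {m} → m < N → ∑[ i < N ] (h (toℕ i) * (X ^ₚ toℕ i) m) ≡ h m
∑X^-coeff (suc N) h {zero} _ = begin
  h 0 * 1ℚ + ∑[ i < N ] (h (suc (toℕ i)) * (X *ₚ (X ^ₚ toℕ i)) 0)
    ≡⟨ cong₂ _+_ (ℚₚ.*-identityʳ (h 0)) (ℚΣ.sum-cong-≗ {N} λ i → trans (cong (h (suc (toℕ i)) *_) (X-*ₚ-zero (X ^ₚ toℕ i))) (ℚₚ.*-zeroʳ (h (suc (toℕ i))))) ⟩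
  h 0 + ∑[ i < N ] 0ℚ
    ≡⟨ cong (λ t → h 0 + t) (ℚΣ.sum-replicate-zero N) ⟩
  h 0 + 0ℚ
    ≡⟨ ℚₚ.+-identityʳ (h 0) ⟩
  h 0
    ∎
  where open ≡-Reasoning
∑X^-coeff (suc N) h {suc m} (s≤s m<N) = begin
  h 0 * 0ℚ + ∑[ i < N ] (h (suc (toℕ i)) * (X *ₚ (X ^ₚ toℕ i)) (suc m))
    ≡⟨ cong₂ _+_ (ℚₚ.*-zeroʳ (h 0)) (ℚΣ.sum-cong-≗ {N} λ i → cong (h (suc (toℕ i)) *_) (X-*ₚ (X ^ₚ toℕ i) m)) ⟩
  0ℚ + ∑[ i < N ] (h (suc (toℕ i)) * (X ^ₚ toℕ i) m)
    ≡⟨ trans (ℚₚ.+-identityˡ _) (∑X^-coeff N (h ∘ suc) m<N) ⟩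
  h (suc m)
    ∎
  where open ≡-Reasoning

bellSeries-zero : ∀ {N} (v : Vector ℚ N) → bellSeries v 0 ≡ 0ℚ
bellSeries-zero {zero}  v = refl
bellSeries-zero {N@(suc _)} v = trans (sum-coeff (bellMonomial v) 0) (trans
  (ℚΣ.sum-cong-≗ {N} λ i → trans (const-*ₚ (v i * (1 /! suc (toℕ i))) (X ^ₚ suc (toℕ i)) 0)
    (trans (cong ((v i * (1 /! suc (toℕ i))) *_) (X-*ₚ-zero (X ^ₚ toℕ i))) (ℚₚ.*-zeroʳ (v i * (1 /! suc (toℕ i))))))
  (ℚΣ.sum-replicate-zero N))

bellSeries-suc : ∀ N (v : ℕ → ℚ) {m} → m < N →
  bellSeries {N} (λ i → v (suc (toℕ i))) (suc m) ≡ v (suc m) * (1 /! suc m)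
bellSeries-suc N v {m} m<N = trans (sum-coeff {N} (bellMonomial (λ i → v (suc (toℕ i)))) (suc m)) (trans
  (ℚΣ.sum-cong-≗ {N} λ i → trans (const-*ₚ (h (toℕ i)) (X ^ₚ suc (toℕ i)) (suc m)) (cong (h (toℕ i) *_) (X-*ₚ (X ^ₚ toℕ i) m)))
  (∑X^-coeff N h m<N))
  where
  h : ℕ → ℚ
  h i = v (suc i) * (1 /! suc i)

^ₚ-order : ∀ {F} → F 0 ≡ 0ℚ → ∀ k {m} → m < k → (F ^ₚ k) m ≡ 0ℚ
^ₚ-order {F} F0 (suc k) {m} m<1+k = trans
  (ℚΣ.sum-cong-≗ {suc m} (λ i → term (toℕ i) (ℕₚ.≤-pred (toℕ<n i))))
  (ℚΣ.sum-replicate-zero (suc m))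
  where
  term : ∀ i → i ≤ m → F i * (F ^ₚ k) (m ∸ i) ≡ 0ℚ
  term zero    i≤m = trans (cong (_* (F ^ₚ k) m) F0) (ℚₚ.*-zeroˡ ((F ^ₚ k) m))
  term (suc i) i≤m = trans
    (cong (F (suc i) *_) (^ₚ-order F0 k (ℕₚ.<-≤-trans (ℕₚ.∸-monoʳ-< (s≤s z≤n) i≤m) (ℕₚ.≤-pred m<1+k))))
    (ℚₚ.*-zeroʳ (F (suc i)))

-- If one of the k factors contributes a degree above d, fewer than k - 1 degrees are left for the k
-- - 1 others. These have no constant term, so by `^ₚ-order` the contribution is zero. Hence only
-- the coefficients up to d matter below degree d + k.
^ₚ-truncate : ∀ {F G d} → F 0 ≡ 0ℚ → G 0 ≡ 0ℚ → (∀ i → i ≤ d → F i ≡ G i) →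
  ∀ k m → m < d ℕ.+ k → (F ^ₚ k) m ≡ (G ^ₚ k) m
^ₚ-truncate F0 G0 agree zero    m _ = refl
^ₚ-truncate {F} {G} {d} F0 G0 agree (suc k) m m<d+1+k =
  ℚΣ.sum-cong-≗ {suc m} (λ i → term (toℕ i) (ℕₚ.≤-pred (toℕ<n i)))
  where
  open ≡-Reasoning
  m≤d+k : m ≤ d ℕ.+ k
  m≤d+k = ℕₚ.≤-pred (subst (m <_) (ℕₚ.+-suc d k) m<d+1+k)
  term : ∀ i → i ≤ m → F i * (F ^ₚ k) (m ∸ i) ≡ G i * (G ^ₚ k) (m ∸ i)
  term zero i≤m = begin
    F 0 * (F ^ₚ k) m   ≡⟨ cong (_* (F ^ₚ k) m) F0 ⟩
    0ℚ * (F ^ₚ k) m    ≡⟨ trans (ℚₚ.*-zeroˡ ((F ^ₚ k) m)) (sym (ℚₚ.*-zeroˡ ((G ^ₚ k) m))) ⟩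
    0ℚ * (G ^ₚ k) m    ≡⟨ cong (_* (G ^ₚ k) m) G0 ⟨
    G 0 * (G ^ₚ k) m   ∎
  term (suc i) i≤m with suc i ℕₚ.≤? d
  ... | yes i≤d = cong₂ _*_ (agree (suc i) i≤d)
    (^ₚ-truncate F0 G0 agree k (m ∸ suc i) (ℕₚ.<-≤-trans (ℕₚ.∸-monoʳ-< (s≤s z≤n) i≤m) m≤d+k))
  ... | no i≰d = begin
    F (suc i) * (F ^ₚ k) (m ∸ suc i)   ≡⟨ cong (F (suc i) *_) (^ₚ-order F0 k low) ⟩
    F (suc i) * 0ℚ                     ≡⟨ trans (ℚₚ.*-zeroʳ (F (suc i))) (sym (ℚₚ.*-zeroʳ (G (suc i)))) ⟩
    G (suc i) * 0ℚ                     ≡⟨ cong (G (suc i) *_) (^ₚ-order G0 k low) ⟨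
    G (suc i) * (G ^ₚ k) (m ∸ suc i)   ∎
    where
    low : m ∸ suc i < k
    low = ℕₚ.<-≤-trans (ℕₚ.∸-monoʳ-< (ℕₚ.≰⇒> i≰d) i≤m) (ℕₚ.m≤n+o⇒m∸n≤o m d m≤d+k)

-- Taylor shift of the falling factorials

z-*ₚ-zero : ∀ a p → ((z- a) *ₚ p) 0 ≡ - a * p 0
z-*ₚ-zero a p = ℚₚ.+-identityʳ (- a * p 0)

z-*ₚ-suc : ∀ a p n → ((z- a) *ₚ p) (suc n) ≡ - a * p (suc n) + p n
z-*ₚ-suc a p n = cong (λ t → - a * p (suc n) + t)
  (trans (*ₚ-cong {(z- a) ∘ suc} {1ₚ} {p} leading (λ _ → refl) n) (*ₚ-identityˡ p n))
  where
  leading : (z- a) ∘ suc ≗ 1ₚ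
  leading zero    = refl
  leading (suc _) = refl

-- The falling factorial at z + c, that is (z + c)(z + c - 1)...(z + c - N + 1).
shifted : ℚ → ℕ → Poly
shifted c zero    = 1ₚ
shifted c (suc N) = (z- (fromℕ N - c)) *ₚ shifted c N

shifted-high : ∀ c {N m} → N < m → shifted c N m ≡ 0ℚ
shifted-high c {zero}  {suc m} _         = refl
shifted-high c {suc N} {suc m} (s≤s N<m) = begin
  ((z- a) *ₚ shifted c N) (suc m)                ≡⟨ z-*ₚ-suc a (shifted c N) m ⟩
  - a * shifted c N (suc m) + shifted c N m      ≡⟨ cong₂ (λ u v → - a * u + v) (shifted-high c (ℕₚ.m<n⇒m<1+n N<m)) (shifted-high c N<m) ⟩
  - a * 0ℚ + 0ℚ                                  ≡⟨ trans (ℚₚ.+-identityʳ (- a * 0ℚ)) (ℚₚ.*-zeroʳ (- a)) ⟩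
  0ℚ                                             ∎
  where
  open ≡-Reasoning
  a = fromℕ N - c

shifted-leading : ∀ c N → shifted c N N ≡ 1ℚ
shifted-leading c zero    = refl
shifted-leading c (suc N) = begin
  ((z- a) *ₚ shifted c N) (suc N)                ≡⟨ z-*ₚ-suc a (shifted c N) N ⟩
  - a * shifted c N (suc N) + shifted c N N      ≡⟨ cong₂ (λ u v → - a * u + v) (shifted-high c (ℕₚ.n<1+n N)) (shifted-leading c N) ⟩
  - a * 0ℚ + 1ℚ                                  ≡⟨ cong (_+ 1ℚ) (ℚₚ.*-zeroʳ (- a)) ⟩
  1ℚ                                             ∎
  where
  open ≡-Reasoning
  a = fromℕ N - c

-- What the summand s(N, m+i) (z + c)^(m+i) contributes to the coefficient of z^m; the sum defining
-- `Q` consists of such terms.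
taylorTerm : ℚ → ℕ → ℕ → ℕ → ℚ
taylorTerm c N m i = fromℕ ((m ℕ.+ i) C m) * s N (m ℕ.+ i) * c ^ i

s-suc : ∀ N m → s (suc N) (suc m) ≡ - fromℕ N * s N (suc m) + s N m
s-suc N m = trans (*ₚ-comm (s N) (z- fromℕ N) (suc m)) (z-*ₚ-suc (fromℕ N) (s N) m)

s-zero : ∀ N → s (suc N) 0 ≡ - fromℕ N * s N 0
s-zero N = trans (*ₚ-comm (s N) (z- fromℕ N) 0) (z-*ₚ-zero (fromℕ N) (s N))

taylor-zero : ∀ c N B →
  ∑[ i < suc B ] taylorTerm c (suc N) 0 (toℕ i)
    ≡ - fromℕ N * ∑[ i < suc B ] taylorTerm c N 0 (toℕ i) + c * ∑[ i < B ] taylorTerm c N 0 (toℕ i)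
taylor-zero c N B = begin
  t′ 0 + ∑[ i < B ] t′ (suc (toℕ i))
    ≡⟨ cong₂ _+_ first (ℚΣ.sum-cong-≗ {B} (λ i → later (toℕ i))) ⟩
  - n * t 0 + ∑[ i < B ] (- n * t (suc (toℕ i)) + c * t (toℕ i))
    ≡⟨ cong (λ z → - n * t 0 + z) (ℚΣ.∑-distrib-+ {B} (λ i → - n * t (suc (toℕ i))) (λ i → c * t (toℕ i))) ⟩
  - n * t 0 + (∑[ i < B ] (- n * t (suc (toℕ i))) + ∑[ i < B ] (c * t (toℕ i)))
    ≡⟨ ℚₚ.+-assoc (- n * t 0) _ _ ⟨
  ∑[ i < suc B ] (- n * t (toℕ i)) + ∑[ i < B ] (c * t (toℕ i))
    ≡⟨ cong₂ _+_ (ℚΣ.*-distribˡ-sum {suc B} (- n) (λ i → t (toℕ i))) (ℚΣ.*-distribˡ-sum {B} c (λ i → t (toℕ i))) ⟨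
  - n * ∑[ i < suc B ] t (toℕ i) + c * ∑[ i < B ] t (toℕ i)
    ∎
  where
  open ≡-Reasoning
  n = fromℕ N
  t t′ : ℕ → ℚ
  t = taylorTerm c N 0
  t′ = taylorTerm c (suc N) 0
  lemma : ∀ b n u v c p → b * (- n * u + v) * (c * p) ≡ - n * (b * u * (c * p)) + c * (b * v * p)
  lemma = solve-∀ ℚ-acr
  lemma₀ : ∀ b n u p → b * (- n * u) * p ≡ - n * (b * u * p)
  lemma₀ = solve-∀ ℚ-acr
  first : t′ 0 ≡ - n * t 0
  first = trans (cong (λ u → fromℕ (0 C 0) * u * c ^ 0) (s-zero N)) (lemma₀ (fromℕ (0 C 0)) n (s N 0) (c ^ 0))
  later : ∀ i → t′ (suc i) ≡ - n * t (suc i) + c * t i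
  later i = trans
    (cong (λ u → fromℕ (suc i C 0) * u * c ^ suc i) (s-suc N i))
    (lemma (fromℕ (suc i C 0)) n (s N (suc i)) (s N i) c (c ^ i))

-- After `s-suc`, Pascal's rule splits the part with s(N, m+i). The coefficient C(m+i, m) gives the
-- terms of order m. The coefficient C(m+i, m+1) vanishes at i = 0 and, reindexed, gives c times the
-- terms of order m + 1 in a sum shorter by one.
taylor-suc : ∀ c N m B →
  ∑[ i < suc B ] taylorTerm c (suc N) (suc m) (toℕ i)
    ≡ - fromℕ N * ∑[ i < suc B ] taylorTerm c N (suc m) (toℕ i)
      + ∑[ i < suc B ] taylorTerm c N m (toℕ i)
      + c * ∑[ i < B ] taylorTerm c N (suc m) (toℕ i)
taylor-suc c N m B = begin
  ∑[ i < suc B ] t′ (toℕ i)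
    ≡⟨ ℚΣ.sum-cong-≗ {suc B} (λ i → split (toℕ i)) ⟩
  ∑[ i < suc B ] (- n * t (toℕ i) + t₋ (toℕ i) + u (toℕ i))
    ≡⟨ ℚΣ.∑-distrib-+ {suc B} (λ i → - n * t (toℕ i) + t₋ (toℕ i)) (λ i → u (toℕ i)) ⟩
  ∑[ i < suc B ] (- n * t (toℕ i) + t₋ (toℕ i)) + ∑[ i < suc B ] u (toℕ i)
    ≡⟨ cong₂ _+_ (ℚΣ.∑-distrib-+ {suc B} (λ i → - n * t (toℕ i)) (λ i → t₋ (toℕ i))) collect ⟩
  ∑[ i < suc B ] (- n * t (toℕ i)) + ∑[ i < suc B ] t₋ (toℕ i) + c * ∑[ i < B ] t (toℕ i)
    ≡⟨ cong (λ z → z + ∑[ i < suc B ] t₋ (toℕ i) + c * ∑[ i < B ] t (toℕ i)) (ℚΣ.*-distribˡ-sum {suc B} (- n) (λ i → t (toℕ i))) ⟨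
  - n * ∑[ i < suc B ] t (toℕ i) + ∑[ i < suc B ] t₋ (toℕ i) + c * ∑[ i < B ] t (toℕ i)
    ∎
  where
  open ≡-Reasoning
  n = fromℕ N
  t t′ t₋ u : ℕ → ℚ
  t  = taylorTerm c N (suc m)
  t′ = taylorTerm c (suc N) (suc m)
  t₋ = taylorTerm c N m
  u i = fromℕ ((m ℕ.+ i) C suc m) * s N (m ℕ.+ i) * c ^ i
  lemma : ∀ a b n v w p → (a + b) * (- n * v + w) * p ≡ - n * ((a + b) * v * p) + a * w * p + b * w * p
  lemma = solve-∀ ℚ-acr
  pascal : ∀ i → fromℕ ((suc m ℕ.+ i) C suc m) ≡ fromℕ ((m ℕ.+ i) C m) + fromℕ ((m ℕ.+ i) C suc m)
  pascal i = trans (cong fromℕ (sym (nCk+nC[k+1]≡[n+1]C[k+1] (m ℕ.+ i) m))) (fromℕ-+ ((m ℕ.+ i) C m) _)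
  split : ∀ i → t′ i ≡ - n * t i + t₋ i + u i
  split i = begin
    fromℕ ((suc m ℕ.+ i) C suc m) * s (suc N) (suc m ℕ.+ i) * c ^ i
      ≡⟨ cong₂ (λ x y → x * y * c ^ i) (pascal i) (s-suc N (m ℕ.+ i)) ⟩
    (a + b) * (- n * s N (suc m ℕ.+ i) + s N (m ℕ.+ i)) * c ^ i
      ≡⟨ lemma a b n (s N (suc m ℕ.+ i)) (s N (m ℕ.+ i)) (c ^ i) ⟩
    - n * ((a + b) * s N (suc m ℕ.+ i) * c ^ i) + t₋ i + u i
      ≡⟨ cong (λ x → - n * (x * s N (suc m ℕ.+ i) * c ^ i) + t₋ i + u i) (pascal i) ⟨
    - n * t i + t₋ i + u i
      ∎
    where
    a b : ℚ
    a = fromℕ ((m ℕ.+ i) C m)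
    b = fromℕ ((m ℕ.+ i) C suc m)
  lemma-u : ∀ a b c d → a * b * (c * d) ≡ c * (a * b * d)
  lemma-u = solve-∀ ℚ-acr
  u-zero : u 0 ≡ 0ℚ
  u-zero = begin
    fromℕ ((m ℕ.+ 0) C suc m) * s N (m ℕ.+ 0) * c ^ 0
      ≡⟨ cong (λ x → fromℕ x * s N (m ℕ.+ 0) * c ^ 0) (k>n⇒nCk≡0 (ℕₚ.≤-reflexive (cong suc (ℕₚ.+-identityʳ m)))) ⟩
    0ℚ * s N (m ℕ.+ 0) * c ^ 0
      ≡⟨ trans (cong (_* c ^ 0) (ℚₚ.*-zeroˡ (s N (m ℕ.+ 0)))) (ℚₚ.*-zeroˡ (c ^ 0)) ⟩
    0ℚ
      ∎
  u-suc : ∀ i → u (suc i) ≡ c * t i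
  u-suc i = trans
    (cong (λ j → fromℕ (j C suc m) * s N j * (c * c ^ i)) (ℕₚ.+-suc m i))
    (lemma-u (fromℕ ((suc m ℕ.+ i) C suc m)) (s N (suc m ℕ.+ i)) c (c ^ i))
  collect : ∑[ i < suc B ] u (toℕ i) ≡ c * ∑[ i < B ] t (toℕ i)
  collect = begin
    u 0 + ∑[ i < B ] u (suc (toℕ i))      ≡⟨ cong₂ _+_ u-zero (ℚΣ.sum-cong-≗ {B} (λ i → u-suc (toℕ i))) ⟩
    0ℚ + ∑[ i < B ] (c * t (toℕ i))       ≡⟨ ℚₚ.+-identityˡ _ ⟩
    ∑[ i < B ] (c * t (toℕ i))            ≡⟨ ℚΣ.*-distribˡ-sum {B} c (λ i → t (toℕ i)) ⟨
    c * ∑[ i < B ] t (toℕ i)              ∎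

-- Both sides obey the recursion in N that comes from multiplication by z - (N - c). The length B is
-- free subject to N < m + B, which ensures that no nonzero term is cut off, because the recursion
-- calls for sums of lengths B and B + 1.
taylor : ∀ c N m B → N < m ℕ.+ B → ∑[ i < B ] taylorTerm c N m (toℕ i) ≡ shifted c N m
taylor c N m zero N<m+0 = sym (shifted-high c (subst (N <_) (ℕₚ.+-identityʳ m) N<m+0))
taylor c zero zero (suc B) _ = begin
  1ℚ + ∑[ i < B ] taylorTerm c 0 0 (suc (toℕ i))    ≡⟨ cong (λ z → 1ℚ + z) (ℚΣ.sum-cong-≗ {B} (λ i → vanish (fromℕ (suc (toℕ i) C 0)) (c ^ suc (toℕ i)))) ⟩
  1ℚ + ∑[ i < B ] 0ℚ                                ≡⟨ cong (λ z → 1ℚ + z) (ℚΣ.sum-replicate-zero B) ⟩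
  1ℚ                                                ∎
  where
  open ≡-Reasoning
  vanish : ∀ a b → a * 0ℚ * b ≡ 0ℚ
  vanish = solve-∀ ℚ-acr
taylor c zero (suc m) (suc B) _ = trans
  (ℚΣ.sum-cong-≗ {suc B} (λ i → vanish (fromℕ ((suc m ℕ.+ toℕ i) C suc m)) (c ^ toℕ i)))
  (ℚΣ.sum-replicate-zero (suc B))
  where
  vanish : ∀ a b → a * 0ℚ * b ≡ 0ℚ
  vanish = solve-∀ ℚ-acr
taylor c (suc N) zero (suc B) (s≤s N<B) = begin
  ∑[ i < suc B ] taylorTerm c (suc N) 0 (toℕ i)
    ≡⟨ taylor-zero c N B ⟩
  - n * ∑[ i < suc B ] taylorTerm c N 0 (toℕ i) + c * ∑[ i < B ] taylorTerm c N 0 (toℕ i)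
    ≡⟨ cong₂ (λ u v → - n * u + c * v) (taylor c N 0 (suc B) (ℕₚ.m<n⇒m<1+n N<B)) (taylor c N 0 B N<B) ⟩
  - n * p + c * p
    ≡⟨ lemma n c p ⟩
  - (n - c) * p
    ≡⟨ z-*ₚ-zero (n - c) (shifted c N) ⟨
  shifted c (suc N) 0
    ∎
  where
  open ≡-Reasoning
  n p : ℚ
  n = fromℕ N
  p = shifted c N 0
  lemma : ∀ n c p → - n * p + c * p ≡ - (n - c) * p
  lemma = solve-∀ ℚ-acr
taylor c (suc N) (suc m) (suc B) (s≤s N<m+1+B) = begin
  ∑[ i < suc B ] taylorTerm c (suc N) (suc m) (toℕ i)
    ≡⟨ taylor-suc c N m B ⟩
  - n * ∑[ i < suc B ] taylorTerm c N (suc m) (toℕ i) + ∑[ i < suc B ] taylorTerm c N m (toℕ i) + c * ∑[ i < B ] taylorTerm c N (suc m) (toℕ i)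
    ≡⟨ cong₂ _+_ (cong₂ (λ u v → - n * u + v) (taylor c N (suc m) (suc B) (ℕₚ.m<n⇒m<1+n N<m+1+B)) (taylor c N m (suc B) N<m+1+B))
                 (cong (c *_) (taylor c N (suc m) B (subst (N <_) (ℕₚ.+-suc m B) N<m+1+B))) ⟩
  - n * p + q + c * p
    ≡⟨ lemma n c p q ⟩
  - (n - c) * p + q
    ≡⟨ z-*ₚ-suc (n - c) (shifted c N) m ⟨
  shifted c (suc N) (suc m)
    ∎
  where
  open ≡-Reasoning
  n p q : ℚ
  n = fromℕ N
  p = shifted c N (suc m)
  q = shifted c N m
  lemma : ∀ n c p q → - n * p + q + c * p ≡ - (n - c) * p + q
  lemma = solve-∀ ℚ-acr

-- The roots on the left are j - (c + 1) for 0 ≤ j ≤ N. Those with j ≥ 1 are the roots of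
-- `shifted c N`, and j = 0 gives the extra root -(c + 1).
shifted-shift : ∀ c N → shifted (c + 1ℚ) (suc N) ≗ (z- (- (c + 1ℚ))) *ₚ shifted c N
shifted-shift c zero = λ n → cong (λ a → ((z- a) *ₚ 1ₚ) n) (ℚₚ.+-identityˡ (- (c + 1ℚ)))
shifted-shift c (suc N) = begin
  (z- (fromℕ (suc N) - (c + 1ℚ))) *ₚ shifted (c + 1ℚ) (suc N)
    ≈⟨ S.*-cong (λ n → cong (λ a → (z- a) n) root) (shifted-shift c N) ⟩
  (z- (fromℕ N - c)) *ₚ ((z- (- (c + 1ℚ))) *ₚ shifted c N)
    ≈⟨ solve 3 (λ a b p → a :* (b :* p) := b :* (a :* p)) S.refl (z- (fromℕ N - c)) (z- (- (c + 1ℚ))) (shifted c N) ⟩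
  (z- (- (c + 1ℚ))) *ₚ ((z- (fromℕ N - c)) *ₚ shifted c N)
    ∎
  where
  open SetoidReasoning S.setoid
  open SemiringSolver seriesSemiring using (solve; _:*_; _:=_)
  lemma : ∀ n c → (1ℚ + n) - (c + 1ℚ) ≡ n - c
  lemma = solve-∀ ℚ-acr
  root : fromℕ (suc N) - (c + 1ℚ) ≡ fromℕ N - c
  root = trans (cong (_- (c + 1ℚ)) (fromℕ-+ 1 N)) (lemma (fromℕ N) c)

-- The roots are symmetric about 0, so the two factors gained from N to N + 2
-- combine to z² - ((N+1)/2)².
centred : ℕ → Poly
centred N = shifted ((fromℕ N - 1ℚ) * ½) N

-- The value α = 2 is the one that makes (m + k - α)/2 equal to (N - 1)/2 for N = m + k - 1, the
-- midpoint of the roots 0, ..., N - 1. With m written as `suc q` the truncated subtractions in `Q`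
-- compute away.
Q≡centred : ∀ q k → Q (suc q) k (fromℕ 2) ≡ centred (q ℕ.+ k) q
Q≡centred q k = trans
  (cong (λ c → ∑[ i < suc k ] taylorTerm c (q ℕ.+ k) q (toℕ i)) centre)
  (taylor _ (q ℕ.+ k) q (suc k) (ℕₚ.≤-reflexive (sym (ℕₚ.+-suc q k))))
  where
  lemma : ∀ n → (1ℚ + n - (1ℚ + 1ℚ)) * ½ ≡ (n - 1ℚ) * ½
  lemma = solve-∀ ℚ-acr
  centre : (fromℕ (suc q ℕ.+ k) - fromℕ 2) * ½ ≡ (fromℕ (q ℕ.+ k) - 1ℚ) * ½
  centre = trans (cong (λ t → (t - fromℕ 2) * ½) (fromℕ-+ 1 (q ℕ.+ k))) (lemma (fromℕ (q ℕ.+ k)))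

-- From N to N + 2 the shift c grows by 1, so the old roots stay in place. The top root (N+1)/2
-- comes from the outermost factor in the definition of `shifted`, the bottom root -(N+1)/2 from
-- `shifted-shift`.
centred-factor : ∀ N → let h = fromℕ (suc N) * ½ in centred (suc (suc N)) ≗ (z- h) *ₚ ((z- (- h)) *ₚ centred N)
centred-factor N n = begin
  shifted ((fromℕ (suc (suc N)) - 1ℚ) * ½) (suc (suc N)) n
    ≡⟨ cong (λ c → shifted c (suc (suc N)) n) (trans (cong (λ t → (t - 1ℚ) * ½) (fromℕ-+ 2 N)) (lemma₁ (fromℕ N))) ⟩
  ((z- (fromℕ (suc N) - (c + 1ℚ))) *ₚ shifted (c + 1ℚ) (suc N)) n
    ≡⟨ *ₚ-cong (λ m → cong (λ a → (z- a) m) root) (shifted-shift c N) n ⟩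
  ((z- h) *ₚ ((z- (- (c + 1ℚ))) *ₚ centred N)) n
    ≡⟨ cong (λ a → ((z- h) *ₚ ((z- (- a)) *ₚ centred N)) n) half ⟩
  ((z- h) *ₚ ((z- (- h)) *ₚ centred N)) n
    ∎
  where
  open ≡-Reasoning
  c h : ℚ
  c = (fromℕ N - 1ℚ) * ½
  h = fromℕ (suc N) * ½
  lemma₁ : ∀ n → (1ℚ + 1ℚ + n - 1ℚ) * ½ ≡ (n - 1ℚ) * ½ + 1ℚ
  lemma₁ = solve-∀ ℚ-acr
  lemma₂ : ∀ n → (n - 1ℚ) * ½ + 1ℚ ≡ (1ℚ + n) * ½
  lemma₂ = solve-∀ ℚ-acr
  lemma₃ : ∀ n → n - n * ½ ≡ n * ½
  lemma₃ = solve-∀ ℚ-acr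
  half : c + 1ℚ ≡ h
  half = trans (lemma₂ (fromℕ N)) (cong (_* ½) (sym (fromℕ-+ 1 N)))
  root : fromℕ (suc N) - (c + 1ℚ) ≡ h
  root = trans (cong (λ t → fromℕ (suc N) - t) half) (lemma₃ (fromℕ (suc N)))

centred-0 : ∀ N → let h = fromℕ (suc N) * ½ in centred (suc (suc N)) 0 ≡ - (h * h) * centred N 0
centred-0 N = begin
  centred (suc (suc N)) 0                    ≡⟨ centred-factor N 0 ⟩
  ((z- h) *ₚ ((z- (- h)) *ₚ centred N)) 0    ≡⟨ z-*ₚ-zero h ((z- (- h)) *ₚ centred N) ⟩
  - h * ((z- (- h)) *ₚ centred N) 0          ≡⟨ cong (- h *_) (z-*ₚ-zero (- h) (centred N)) ⟩
  - h * (- - h * centred N 0)                ≡⟨ lemma h (centred N 0) ⟩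
  - (h * h) * centred N 0                    ∎
  where
  open ≡-Reasoning
  h = fromℕ (suc N) * ½
  lemma : ∀ h p → - h * (- - h * p) ≡ - (h * h) * p
  lemma = solve-∀ ℚ-acr

centred-1 : ∀ N → let h = fromℕ (suc N) * ½ in centred (suc (suc N)) 1 ≡ - (h * h) * centred N 1
centred-1 N = begin
  centred (suc (suc N)) 1
    ≡⟨ centred-factor N 1 ⟩
  ((z- h) *ₚ ((z- (- h)) *ₚ centred N)) 1
    ≡⟨ z-*ₚ-suc h ((z- (- h)) *ₚ centred N) 0 ⟩
  - h * ((z- (- h)) *ₚ centred N) 1 + ((z- (- h)) *ₚ centred N) 0
    ≡⟨ cong₂ (λ u v → - h * u + v) (z-*ₚ-suc (- h) (centred N) 0) (z-*ₚ-zero (- h) (centred N)) ⟩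
  - h * (- - h * centred N 1 + centred N 0) + - - h * centred N 0
    ≡⟨ lemma h (centred N 1) (centred N 0) ⟩
  - (h * h) * centred N 1
    ∎
  where
  open ≡-Reasoning
  h = fromℕ (suc N) * ½
  lemma : ∀ h p q → - h * (- - h * p + q) + - - h * q ≡ - (h * h) * p
  lemma = solve-∀ ℚ-acr

centred-suc-suc : ∀ N m → let h = fromℕ (suc N) * ½ in
  centred (suc (suc N)) (suc (suc m)) ≡ - (h * h) * centred N (suc (suc m)) + centred N m
centred-suc-suc N m = begin
  centred (suc (suc N)) (suc (suc m))
    ≡⟨ centred-factor N (suc (suc m)) ⟩
  ((z- h) *ₚ ((z- (- h)) *ₚ centred N)) (suc (suc m))
    ≡⟨ z-*ₚ-suc h ((z- (- h)) *ₚ centred N) (suc m) ⟩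
  - h * ((z- (- h)) *ₚ centred N) (suc (suc m)) + ((z- (- h)) *ₚ centred N) (suc m)
    ≡⟨ cong₂ (λ u v → - h * u + v) (z-*ₚ-suc (- h) (centred N) (suc m)) (z-*ₚ-suc (- h) (centred N) m) ⟩
  - h * (- - h * centred N (suc (suc m)) + centred N (suc m)) + (- - h * centred N (suc m) + centred N m)
    ≡⟨ lemma h (centred N (suc (suc m))) (centred N (suc m)) (centred N m) ⟩
  - (h * h) * centred N (suc (suc m)) + centred N m
    ∎
  where
  open ≡-Reasoning
  h = fromℕ (suc N) * ½
  lemma : ∀ h p q r → - h * (- - h * p + q) + (- - h * q + r) ≡ - (h * h) * p + r
  lemma = solve-∀ ℚ-acr

-- Powers of the arcsine series

-- The junk value x 0 is 1, so V is arcsin t / t including its constant term.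
V arcsin : Poly
V i = x i * (1 /! i)

arcsin zero    = 0ℚ
arcsin (suc i) = V i

1/!-suc : ∀ n → (1 /! suc n) * fromℕ (suc n) ≡ 1 /! n
1/!-suc n = fromℕ-cancelʳ (n !) {{n ℕₚ.!≢0}} (begin
  (1 /! suc n) * fromℕ (suc n) * fromℕ (n !)      ≡⟨ lemma (1 /! suc n) (fromℕ (suc n)) (fromℕ (n !)) ⟩
  (fromℕ (suc n) * fromℕ (n !)) * (1 /! suc n)    ≡⟨ cong (_* (1 /! suc n)) (fromℕ-* (suc n) (n !)) ⟨
  fromℕ (suc n !) * (1 /! suc n)                  ≡⟨ !-inverse (suc n) ⟩
  1ℚ                                              ≡⟨ !-inverse n ⟨
  fromℕ (n !) * (1 /! n)                          ≡⟨ ℚₚ.*-comm (fromℕ (n !)) (1 /! n) ⟩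
  (1 /! n) * fromℕ (n !)                          ∎)
  where
  open ≡-Reasoning
  lemma : ∀ a b c → a * b * c ≡ (b * c) * a
  lemma = solve-∀ ℚ-acr

-- The double factorial satisfies (i+1)!! = (i+1) (i-1)!!, and the parity factor has period two, so
-- no distinction between even and odd i is needed. At i = 0 the truncated `0 ∸ 1` yields 0!! = 1,
-- which agrees with (-1)!!.
x-step : ∀ i → let n = fromℕ (suc i) in x (suc (suc i)) * fromℕ (suc (suc (suc i))) ≡ n * n * (x i * n)
x-step i = begin
  e′ * (+ (((suc i) !!) ℕ.^ 2) / suc (suc (suc i))) * fromℕ (suc (suc (suc i)))
    ≡⟨ trans (ℚₚ.*-assoc e′ _ _) (cong (e′ *_) (/-*-cancel (((suc i) !!) ℕ.^ 2) (suc (suc (suc i))))) ⟩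
  e′ * fromℕ (((suc i) !!) ℕ.^ 2)
    ≡⟨ cong (λ d → e′ * fromℕ (d ℕ.^ 2)) (!!-suc i) ⟩
  e′ * fromℕ ((suc i ℕ.* d) ℕ.^ 2)
    ≡⟨ cong (e′ *_) (trans (square (suc i ℕ.* d)) (cong₂ _*_ (fromℕ-* (suc i) d) (fromℕ-* (suc i) d))) ⟩
  e′ * ((n * fromℕ d) * (n * fromℕ d))
    ≡⟨ lemma ((- 1ℚ) ^ i) n (fromℕ d) ⟩
  n * n * (e * (fromℕ d * fromℕ d))
    ≡⟨ cong (λ t → n * n * (e * t)) (square d) ⟨
  n * n * (e * fromℕ (d ℕ.^ 2))
    ≡⟨ cong (n * n *_) (trans (ℚₚ.*-assoc e _ n) (cong (e *_) (/-*-cancel (d ℕ.^ 2) (suc i)))) ⟨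
  n * n * (x i * n)
    ∎
  where
  open ≡-Reasoning
  n e e′ : ℚ
  n = fromℕ (suc i)
  e = (1ℚ + (- 1ℚ) ^ i) * ½
  e′ = (1ℚ + (- 1ℚ) ^ suc (suc i)) * ½
  d : ℕ
  d = (i ∸ 1) !!
  square : ∀ a → fromℕ (a ℕ.^ 2) ≡ fromℕ a * fromℕ a
  square a = trans (cong (λ t → fromℕ (a ℕ.* t)) (ℕₚ.*-identityʳ a)) (fromℕ-* a a)
  !!-suc : ∀ j → (suc j) !! ≡ suc j ℕ.* (j ∸ 1) !!
  !!-suc zero    = refl
  !!-suc (suc j) = refl
  lemma : ∀ p n d → (1ℚ + - 1ℚ * (- 1ℚ * p)) * ½ * ((n * d) * (n * d)) ≡ n * n * ((1ℚ + p) * ½ * (d * d))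
  lemma = solve-∀ ℚ-acr

V-step : ∀ i → fromℕ (3 ℕ.+ i) * fromℕ (2 ℕ.+ i) * V (2 ℕ.+ i) ≡ fromℕ (1 ℕ.+ i) * fromℕ (1 ℕ.+ i) * V i
V-step i = begin
  n₃ * n₂ * (x (2 ℕ.+ i) * f₂)        ≡⟨ lemma₁ n₃ n₂ (x (2 ℕ.+ i)) f₂ ⟩
  (x (2 ℕ.+ i) * n₃) * (f₂ * n₂)      ≡⟨ cong₂ _*_ (x-step i) (1/!-suc (suc i)) ⟩
  n₁ * n₁ * (x i * n₁) * f₁           ≡⟨ lemma₂ n₁ (x i) f₁ ⟩
  n₁ * n₁ * (x i * (f₁ * n₁))         ≡⟨ cong (λ t → n₁ * n₁ * (x i * t)) (1/!-suc i) ⟩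
  n₁ * n₁ * (x i * (1 /! i))          ∎
  where
  open ≡-Reasoning
  n₁ n₂ n₃ f₁ f₂ : ℚ
  n₁ = fromℕ (1 ℕ.+ i)
  n₂ = fromℕ (2 ℕ.+ i)
  n₃ = fromℕ (3 ℕ.+ i)
  f₁ = 1 /! (1 ℕ.+ i)
  f₂ = 1 /! (2 ℕ.+ i)
  lemma₁ : ∀ a b c d → a * b * (c * d) ≡ (c * a) * (d * b)
  lemma₁ = solve-∀ ℚ-acr
  lemma₂ : ∀ a c d → a * a * (c * a) * d ≡ a * a * (c * (d * a))
  lemma₂ = solve-∀ ℚ-acr

1-X² : Poly
1-X² zero                = 1ℚ
1-X² (suc zero)          = 0ℚ
1-X² (suc (suc zero))    = - 1ℚ
1-X² (suc (suc (suc _))) = 0ℚ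

1-X²-*ₚ : ∀ p m → (1-X² *ₚ p) (suc (suc m)) ≡ p (suc (suc m)) - p m
1-X²-*ₚ p m = begin
  1ℚ * p (suc (suc m)) + (0ℚ * p (suc m) + (t *ₚ p) m)
    ≡⟨ cong (λ y → 1ℚ * p (suc (suc m)) + (0ℚ * p (suc m) + y)) (trans (*ₚ-cong {t} {r = p} t-const (λ _ → refl) m) (const-*ₚ (- 1ℚ) p m)) ⟩
  1ℚ * p (suc (suc m)) + (0ℚ * p (suc m) + - 1ℚ * p m)
    ≡⟨ lemma (p (suc (suc m))) (p (suc m)) (p m) ⟩
  p (suc (suc m)) - p m
    ∎
  where
  open ≡-Reasoning
  t : Poly
  t i = 1-X² (suc (suc i))
  t-const : t ≗ const (- 1ℚ)
  t-const zero    = refl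
  t-const (suc _) = refl
  lemma : ∀ a b c → 1ℚ * a + (0ℚ * b + - 1ℚ * c) ≡ a - c
  lemma = solve-∀ ℚ-acr

-- For coefficients a_m and m = i + 3 the claim is m² a_m - (m-2)² a_(m-2) = m a_m, that is m (m-1)
-- a_m = (m-2)² a_(m-2), which is `V-step i`.
arcsin-linear : 1-X² *ₚ θ (θ arcsin) ≗ θ arcsin
arcsin-linear zero                = refl
arcsin-linear (suc zero)          = refl
arcsin-linear (suc (suc zero))    = refl
arcsin-linear (suc (suc (suc i))) = begin
  (1-X² *ₚ θ (θ arcsin)) (3 ℕ.+ i)
    ≡⟨ 1-X²-*ₚ (θ (θ arcsin)) (suc i) ⟩
  n₃ * (n₃ * V (2 ℕ.+ i)) - n₁ * (n₁ * V i)
    ≡⟨ cong (λ t → t * (n₃ * V (2 ℕ.+ i)) - n₁ * (n₁ * V i)) (fromℕ-+ 1 (2 ℕ.+ i)) ⟩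
  (1ℚ + n₂) * (n₃ * V (2 ℕ.+ i)) - n₁ * (n₁ * V i)
    ≡⟨ lemma₁ n₁ n₂ n₃ (V (2 ℕ.+ i)) (V i) ⟩
  n₃ * V (2 ℕ.+ i) + (n₃ * n₂ * V (2 ℕ.+ i) - n₁ * n₁ * V i)
    ≡⟨ cong (λ t → n₃ * V (2 ℕ.+ i) + (t - n₁ * n₁ * V i)) (V-step i) ⟩
  n₃ * V (2 ℕ.+ i) + (n₁ * n₁ * V i - n₁ * n₁ * V i)
    ≡⟨ lemma₂ (n₃ * V (2 ℕ.+ i)) (n₁ * n₁ * V i) ⟩
  n₃ * V (2 ℕ.+ i)
    ∎
  where
  open ≡-Reasoning
  n₁ n₂ n₃ : ℚ
  n₁ = fromℕ (1 ℕ.+ i)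
  n₂ = fromℕ (2 ℕ.+ i)
  n₃ = fromℕ (3 ℕ.+ i)
  lemma₁ : ∀ a b c u v → (1ℚ + b) * (c * u) - a * (a * v) ≡ c * u + (c * b * u - a * a * v)
  lemma₁ = solve-∀ ℚ-acr
  lemma₂ : ∀ a b → a + (b - b) ≡ a
  lemma₂ = solve-∀ ℚ-acr

-- Both sides solve θ F = 2 F, which determines F up to its X² coefficient.
arcsin-quadratic : 1-X² *ₚ (θ arcsin *ₚ θ arcsin) ≗ X *ₚ X
arcsin-quadratic zero                = refl
arcsin-quadratic (suc zero)          = refl
arcsin-quadratic (suc (suc zero))    = refl
arcsin-quadratic (suc (suc (suc m))) = trans vanish (sym (X-*ₚ X (suc (suc m))))
  where
  B F : Poly
  B = θ arcsin
  F = 1-X² *ₚ (B *ₚ B)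
  θ1-X² : θ 1-X² +ₚ (1ₚ +ₚ 1ₚ) ≗ 1-X² +ₚ 1-X²
  θ1-X² zero                = refl
  θ1-X² (suc zero)          = refl
  θ1-X² (suc (suc zero))    = refl
  θ1-X² (suc (suc (suc n))) = cong (_+ (0ℚ + 0ℚ)) (ℚₚ.*-zeroʳ (fromℕ (3 ℕ.+ n)))
  -- Here θ(1 - t²) = 2 (1 - t²) - 2 and (1 - t²) θB = B, so the Leibniz rule gives θF = 2 F. The
  -- summand 2 B² is added on both sides to keep the computation free of negation.
  θF : θ F +ₚ ((B *ₚ B) +ₚ (B *ₚ B)) ≗ (F +ₚ F) +ₚ ((B *ₚ B) +ₚ (B *ₚ B))
  θF = begin
    θ F +ₚ (BB +ₚ BB)
      ≈⟨ S.+-congʳ {BB +ₚ BB} (S.trans {θ F} (θ-*ₚ 1-X² BB) (S.+-congˡ {θ 1-X² *ₚ BB} (S.*-congˡ {1-X²} (θ-*ₚ B B)))) ⟩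
    (θ 1-X² *ₚ BB +ₚ 1-X² *ₚ (θ B *ₚ B +ₚ B *ₚ θ B)) +ₚ (BB +ₚ BB)
      ≈⟨ solve 4 (λ d e b u → (d :* (b :* b) :+ e :* (u :* b :+ b :* u)) :+ (b :* b :+ b :* b)
                   := (d :+ (con 1 :+ con 1)) :* (b :* b) :+ ((e :* u) :* b :+ (e :* u) :* b)) S.refl (θ 1-X²) 1-X² B (θ B) ⟩
    (θ 1-X² +ₚ ((1ₚ +ₚ 0ₚ) +ₚ (1ₚ +ₚ 0ₚ))) *ₚ BB +ₚ ((1-X² *ₚ θ B) *ₚ B +ₚ (1-X² *ₚ θ B) *ₚ B)
      ≈⟨ S.+-cong
           (S.*-congʳ {BB} (S.trans {θ 1-X² +ₚ ((1ₚ +ₚ 0ₚ) +ₚ (1ₚ +ₚ 0ₚ))} (S.+-congˡ {θ 1-X²} (S.+-cong (S.+-identityʳ 1ₚ) (S.+-identityʳ 1ₚ))) θ1-X²))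
           (S.+-cong (S.*-congʳ {B} arcsin-linear) (S.*-congʳ {B} arcsin-linear)) ⟩
    (1-X² +ₚ 1-X²) *ₚ BB +ₚ (BB +ₚ BB)
      ≈⟨ S.+-congʳ {BB +ₚ BB} (S.distribʳ BB 1-X² 1-X²) ⟩
    (F +ₚ F) +ₚ (BB +ₚ BB)
      ∎
    where
    open SetoidReasoning S.setoid
    open SemiringSolver seriesSemiring using (solve; _:*_; _:+_; _:=_; con)
    BB : Poly
    BB = B *ₚ B
  open ≡-Reasoning
  lemma₁ : ∀ n a → a * (1ℚ + n) ≡ (1ℚ + 1ℚ + 1ℚ + n) * a - (a + a)
  lemma₁ = solve-∀ ℚ-acr
  lemma₂ : ∀ a n → a - a ≡ 0ℚ * n
  lemma₂ = solve-∀ ℚ-acr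
  vanish : F (3 ℕ.+ m) ≡ 0ℚ
  vanish = fromℕ-cancelʳ (suc m) (begin
    Fₘ * fromℕ (suc m)                       ≡⟨ cong (Fₘ *_) (fromℕ-+ 1 m) ⟩
    Fₘ * (1ℚ + fromℕ m)                      ≡⟨ lemma₁ (fromℕ m) Fₘ ⟩
    (1ℚ + 1ℚ + 1ℚ + fromℕ m) * Fₘ - (Fₘ + Fₘ) ≡⟨ cong (λ t → t * Fₘ - (Fₘ + Fₘ)) (fromℕ-+ 3 m) ⟨
    θ F (3 ℕ.+ m) - (Fₘ + Fₘ)                ≡⟨ cong (_- (Fₘ + Fₘ)) (GroupProperties.∙-cancelʳ ℚₚ.+-0-group _ (θ F (3 ℕ.+ m)) (Fₘ + Fₘ) (θF (3 ℕ.+ m))) ⟩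
    (Fₘ + Fₘ) - (Fₘ + Fₘ)                    ≡⟨ lemma₂ (Fₘ + Fₘ) (fromℕ (suc m)) ⟩
    0ℚ * fromℕ (suc m)                       ∎)
    where
    Fₘ : ℚ
    Fₘ = F (3 ℕ.+ m)

square-X-*ₚ : ∀ p m → (p *ₚ (X *ₚ X)) (suc (suc m)) ≡ p m
square-X-*ₚ p m = begin
  (p *ₚ (X *ₚ X)) (2 ℕ.+ m)     ≡⟨ *ₚ-comm p (X *ₚ X) (2 ℕ.+ m) ⟩
  ((X *ₚ X) *ₚ p) (2 ℕ.+ m)     ≡⟨ *ₚ-assoc X X p (2 ℕ.+ m) ⟩
  (X *ₚ (X *ₚ p)) (2 ℕ.+ m)     ≡⟨ X-*ₚ (X *ₚ p) (suc m) ⟩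
  (X *ₚ p) (suc m)              ≡⟨ X-*ₚ p m ⟩
  p m                           ∎
  where open ≡-Reasoning

θ-cong : ∀ {p q} → p ≗ q → θ p ≗ θ q
θ-cong p≗q n = cong (fromℕ n *_) (p≗q n)

θ-0ₚ : θ 0ₚ ≗ 0ₚ
θ-0ₚ n = ℚₚ.*-zeroʳ (fromℕ n)

θ-1ₚ : θ 1ₚ ≗ 0ₚ
θ-1ₚ zero    = refl
θ-1ₚ (suc n) = ℚₚ.*-zeroʳ (fromℕ (suc n))

θ-+ₚ : ∀ p q → θ (p +ₚ q) ≗ θ p +ₚ θ q
θ-+ₚ p q n = ℚₚ.*-distribˡ-+ (fromℕ n) (p n) (q n)

module ArcsinODE = SemiringPowers.PowerODE seriesSemiring
  θ θ-cong θ-0ₚ θ-1ₚ θ-+ₚ θ-*ₚ arcsin 1-X² (X *ₚ X) arcsin-linear arcsin-quadratic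
open ArcsinODE using (H)

-- The coefficient of t^(m+2) in `θθ-power`: the factor 1 - t² couples the degrees m + 2 and m, and
-- the factor t² brings `H q` back to degree m. Subtracting (m+2) P from (m+2)² P leaves the product
-- (m+2)(m+1).
power-recurrence : ∀ q m → let n = fromℕ m in
  fromℕ (2 ℕ.+ m) * fromℕ (1 ℕ.+ m) * (arcsin ^ₚ q) (2 ℕ.+ m) ≡ n * n * (arcsin ^ₚ q) m + H q m
power-recurrence q m = begin
  fromℕ (2 ℕ.+ m) * fromℕ (1 ℕ.+ m) * P (2 ℕ.+ m)
    ≡⟨ cong₂ (λ a b → a * b * P (2 ℕ.+ m)) (fromℕ-+ 2 m) (fromℕ-+ 1 m) ⟩
  (1ℚ + 1ℚ + n) * (1ℚ + n) * P (2 ℕ.+ m)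
    ≡⟨ lemma₁ n (P (2 ℕ.+ m)) (P m) ⟩
  ((1ℚ + 1ℚ + n) * ((1ℚ + 1ℚ + n) * P (2 ℕ.+ m)) - n * (n * P m)) - (1ℚ + 1ℚ + n) * P (2 ℕ.+ m) + n * n * P m
    ≡⟨ cong (λ a → (a * (a * P (2 ℕ.+ m)) - n * (n * P m)) - a * P (2 ℕ.+ m) + n * n * P m) (fromℕ-+ 2 m) ⟨
  (θ (θ P) (2 ℕ.+ m) - θ (θ P) m) - θ P (2 ℕ.+ m) + n * n * P m
    ≡⟨ cong (λ a → a - θ P (2 ℕ.+ m) + n * n * P m) (1-X²-*ₚ (θ (θ P)) m) ⟨
  (1-X² *ₚ θ (θ P)) (2 ℕ.+ m) - θ P (2 ℕ.+ m) + n * n * P m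
    ≡⟨ cong (λ a → a - θ P (2 ℕ.+ m) + n * n * P m) (ArcsinODE.θθ-power q (2 ℕ.+ m)) ⟩
  ((H q *ₚ (X *ₚ X)) (2 ℕ.+ m) + θ P (2 ℕ.+ m)) - θ P (2 ℕ.+ m) + n * n * P m
    ≡⟨ cong (λ a → (a + θ P (2 ℕ.+ m)) - θ P (2 ℕ.+ m) + n * n * P m) (square-X-*ₚ (H q) m) ⟩
  (H q m + θ P (2 ℕ.+ m)) - θ P (2 ℕ.+ m) + n * n * P m
    ≡⟨ lemma₂ (H q m) (θ P (2 ℕ.+ m)) (n * n * P m) ⟩
  n * n * P m + H q m
    ∎
  where
  open ≡-Reasoning
  n = fromℕ m
  P = arcsin ^ₚ q
  lemma₁ : ∀ n p r → (1ℚ + 1ℚ + n) * (1ℚ + n) * p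
    ≡ ((1ℚ + 1ℚ + n) * ((1ℚ + 1ℚ + n) * p) - n * (n * r)) - (1ℚ + 1ℚ + n) * p + n * n * r
  lemma₁ = solve-∀ ℚ-acr
  lemma₂ : ∀ h t r → (h + t) - t + r ≡ r + h
  lemma₂ = solve-∀ ℚ-acr

H-coeff : ∀ q m → H (suc (suc q)) m ≡ fromℕ (suc (suc q)) * fromℕ (suc q) * (arcsin ^ₚ q) m
H-coeff q m = begin
  H (suc (suc q)) m                      ≡⟨ ArcsinODE.H-suc-suc q m ⟩
  ((b *ₚ a) *ₚ P) m                      ≡⟨ *ₚ-assoc b a P m ⟩
  (b *ₚ (a *ₚ P)) m                      ≡⟨ scalar (suc (suc q)) (a *ₚ P) ⟩
  fromℕ (suc (suc q)) * (a *ₚ P) m       ≡⟨ cong (fromℕ (suc (suc q)) *_) (scalar (suc q) P) ⟩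
  fromℕ (suc (suc q)) * (fromℕ (suc q) * P m)  ≡⟨ ℚₚ.*-assoc (fromℕ (suc (suc q))) (fromℕ (suc q)) (P m) ⟨
  fromℕ (suc (suc q)) * fromℕ (suc q) * P m    ∎
  where
  open ≡-Reasoning
  open SemiringMult S.semiring using (×-assoc-*)
  a b P : Poly
  a = suc q ×ₚ 1ₚ
  b = suc (suc q) ×ₚ 1ₚ
  P = arcsin ^ₚ q
  scalar : ∀ j p → ((j ×ₚ 1ₚ) *ₚ p) m ≡ fromℕ j * p m
  scalar j p = trans (×-assoc-* j 1ₚ p m)
    (trans (×ₚ-coeff j (1ₚ *ₚ p) m) (cong (fromℕ j *_) (*ₚ-identityˡ p m)))

-- The coefficient of tᵐ / m! in (arcsin t)^q / q!.
β : ℕ → ℕ → ℚ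
β q m = fromℕ (m !) * ((1 /! q) * (arcsin ^ₚ q) m)

β-step : ∀ q m → let n = fromℕ m in β q (2 ℕ.+ m) ≡ n * n * β q m + fromℕ (m !) * ((1 /! q) * H q m)
β-step q m = begin
  fromℕ ((2 ℕ.+ m) !) * (f * P (2 ℕ.+ m))
    ≡⟨ cong (_* (f * P (2 ℕ.+ m))) (trans (fromℕ-* (2 ℕ.+ m) (suc m !)) (cong (fromℕ (2 ℕ.+ m) *_) (fromℕ-* (suc m) (m !)))) ⟩
  fromℕ (2 ℕ.+ m) * (fromℕ (suc m) * fromℕ (m !)) * (f * P (2 ℕ.+ m))
    ≡⟨ lemma₁ (fromℕ (2 ℕ.+ m)) (fromℕ (suc m)) (fromℕ (m !)) f (P (2 ℕ.+ m)) ⟩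
  fromℕ (m !) * (f * (fromℕ (2 ℕ.+ m) * fromℕ (suc m) * P (2 ℕ.+ m)))
    ≡⟨ cong (λ a → fromℕ (m !) * (f * a)) (power-recurrence q m) ⟩
  fromℕ (m !) * (f * (n * n * P m + H q m))
    ≡⟨ lemma₂ (fromℕ (m !)) f n (P m) (H q m) ⟩
  n * n * (fromℕ (m !) * (f * P m)) + fromℕ (m !) * (f * H q m)
    ∎
  where
  open ≡-Reasoning
  n = fromℕ m
  f = 1 /! q
  P = arcsin ^ₚ q
  lemma₁ : ∀ a b c d e → a * (b * c) * (d * e) ≡ c * (d * (a * b * e))
  lemma₁ = solve-∀ ℚ-acr
  lemma₂ : ∀ a f n p h → a * (f * (n * n * p + h)) ≡ n * n * (a * (f * p)) + a * (f * h)
  lemma₂ = solve-∀ ℚ-acr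

β-1-step : ∀ m → β 1 (2 ℕ.+ m) ≡ fromℕ m * fromℕ m * β 1 m
β-1-step m = trans (β-step 1 m) (trans
  (cong (λ h → fromℕ m * fromℕ m * β 1 m + fromℕ (m !) * ((1 /! 1) * h)) (ArcsinODE.H-one m))
  (lemma (fromℕ m * fromℕ m * β 1 m) (fromℕ (m !)) (1 /! 1)))
  where
  lemma : ∀ a b c → a + b * (c * 0ℚ) ≡ a
  lemma = solve-∀ ℚ-acr

-- The factor (q+2)(q+1) of `H` cancels against 1/(q+2)!, so the inhomogeneous term is again a `β`,
-- two orders lower.
β-suc-suc-step : ∀ q m → β (2 ℕ.+ q) (2 ℕ.+ m) ≡ fromℕ m * fromℕ m * β (2 ℕ.+ q) m + β q m
β-suc-suc-step q m = trans (β-step (2 ℕ.+ q) m) (cong (λ t → fromℕ m * fromℕ m * β (2 ℕ.+ q) m + fromℕ (m !) * t) (begin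
  f₂ * H (2 ℕ.+ q) m             ≡⟨ cong (f₂ *_) (H-coeff q m) ⟩
  f₂ * (n₂ * n₁ * P)             ≡⟨ lemma f₂ n₂ n₁ P ⟩
  f₂ * n₂ * n₁ * P               ≡⟨ cong (λ t → t * n₁ * P) (1/!-suc (suc q)) ⟩
  (1 /! suc q) * n₁ * P          ≡⟨ cong (_* P) (1/!-suc q) ⟩
  (1 /! q) * P                   ∎))
  where
  open ≡-Reasoning
  n₁ n₂ f₂ P : ℚ
  n₁ = fromℕ (suc q)
  n₂ = fromℕ (2 ℕ.+ q)
  f₂ = 1 /! (2 ℕ.+ q)
  P = (arcsin ^ₚ q) m
  lemma : ∀ a b c d → a * (b * c * d) ≡ a * b * c * d
  lemma = solve-∀ ℚ-acr

arcsin≗X*V : arcsin ≗ X *ₚ V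
arcsin≗X*V zero    = sym (X-*ₚ-zero V)
arcsin≗X*V (suc n) = sym (X-*ₚ V n)

V^-zero : ∀ q → (V ^ₚ q) 0 ≡ 1ℚ
V^-zero zero    = refl
V^-zero (suc q) = cong (λ t → V 0 * t + 0ℚ) (V^-zero q)

-- Since arcsin t = t V with V(0) = 1, the lowest coefficient of arcsin^q is 1 and sits in degree q.
β-diagonal : ∀ q → β q q ≡ 1ℚ
β-diagonal q = begin
  fromℕ (q !) * ((1 /! q) * (arcsin ^ₚ q) q)  ≡⟨ cong (λ t → fromℕ (q !) * ((1 /! q) * t)) leading ⟩
  fromℕ (q !) * ((1 /! q) * 1ℚ)               ≡⟨ cong (fromℕ (q !) *_) (ℚₚ.*-identityʳ (1 /! q)) ⟩
  fromℕ (q !) * (1 /! q)                      ≡⟨ !-inverse q ⟩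
  1ℚ                                          ∎
  where
  open ≡-Reasoning
  leading : (arcsin ^ₚ q) q ≡ 1ℚ
  leading = begin
    (arcsin ^ₚ q) q                      ≡⟨ S^.^-congˡ q arcsin≗X*V q ⟩
    ((X *ₚ V) ^ₚ q) q                    ≡⟨ S^.^-distrib-* X V q q ⟩
    ((X ^ₚ q) *ₚ (V ^ₚ q)) q             ≡⟨ cong ((X ^ₚ q) *ₚ (V ^ₚ q)) (ℕₚ.+-identityʳ q) ⟨
    ((X ^ₚ q) *ₚ (V ^ₚ q)) (q ℕ.+ 0)     ≡⟨ X^-*ₚ q (V ^ₚ q) 0 ⟩
    (V ^ₚ q) 0                           ≡⟨ V^-zero q ⟩
    1ℚ                                   ∎

-- Here n counts the steps of two above the diagonal, each worth a factor -4. The lower term of the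
-- recurrence has order q - 2 at the shorter length N - 2, again n steps above its diagonal; so that
-- call keeps n while q drops by two. `N` is tied to n and q by an equation because this index
-- agrees only propositionally.
β≡centred : ∀ n q N → N ≡ n ℕ.* 2 ℕ.+ q → β (suc q) (suc N) ≡ (- fromℕ 4) ^ n * centred N q
β≡centred zero    q _ refl = trans (β-diagonal (suc q))
  (sym (trans (ℚₚ.*-identityˡ (centred q q)) (shifted-leading _ q)))
β≡centred (suc n) zero _ refl = begin
  β 1 (3 ℕ.+ M)                                        ≡⟨ β-1-step (suc M) ⟩
  fromℕ (suc M) * fromℕ (suc M) * β 1 (suc M)          ≡⟨ cong (fromℕ (suc M) * fromℕ (suc M) *_) (β≡centred n 0 M refl) ⟩
  fromℕ (suc M) * fromℕ (suc M) * (D * centred M 0)    ≡⟨ lemma (fromℕ (suc M)) D (centred M 0) ⟩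
  (- fromℕ 4 * D) * (- (h * h) * centred M 0)          ≡⟨ cong ((- fromℕ 4 * D) *_) (centred-0 M) ⟨
  (- fromℕ 4 * D) * centred (2 ℕ.+ M) 0                ∎
  where
  open ≡-Reasoning
  M = n ℕ.* 2 ℕ.+ 0
  D = (- fromℕ 4) ^ n
  h = fromℕ (suc M) * ½
  lemma : ∀ m d p → m * m * (d * p) ≡ (- fromℕ 4 * d) * (- ((m * ½) * (m * ½)) * p)
  lemma = solve-∀ ℚ-acr
β≡centred (suc n) (suc zero) _ refl = begin
  β 2 (3 ℕ.+ M)                                             ≡⟨ β-suc-suc-step 0 (suc M) ⟩
  -- `β 0` vanishes in positive degree, arcsin^0 being the constant 1. Correspondingly the z² gained
  -- by the centred product does not reach the coefficient of z.
  fromℕ (suc M) * fromℕ (suc M) * β 2 (suc M) + β 0 (suc M) ≡⟨ cong₂ (λ u v → fromℕ (suc M) * fromℕ (suc M) * u + fromℕ (suc M !) * v) (β≡centred n 1 M refl) (ℚₚ.*-zeroʳ (1 /! 0)) ⟩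
  fromℕ (suc M) * fromℕ (suc M) * (D * centred M 1) + fromℕ (suc M !) * 0ℚ
                                                            ≡⟨ lemma (fromℕ (suc M)) D (centred M 1) (fromℕ (suc M !)) ⟩
  (- fromℕ 4 * D) * (- (h * h) * centred M 1)               ≡⟨ cong ((- fromℕ 4 * D) *_) (centred-1 M) ⟨
  (- fromℕ 4 * D) * centred (2 ℕ.+ M) 1                     ∎
  where
  open ≡-Reasoning
  M = n ℕ.* 2 ℕ.+ 1
  D = (- fromℕ 4) ^ n
  h = fromℕ (suc M) * ½
  lemma : ∀ m d p z → m * m * (d * p) + z * 0ℚ ≡ (- fromℕ 4 * d) * (- ((m * ½) * (m * ½)) * p)
  lemma = solve-∀ ℚ-acr
β≡centred (suc n) (suc (suc q)) _ refl = begin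
  β (3 ℕ.+ q) (3 ℕ.+ M)
    ≡⟨ β-suc-suc-step (suc q) (suc M) ⟩
  fromℕ (suc M) * fromℕ (suc M) * β (3 ℕ.+ q) (suc M) + β (suc q) (suc M)
    ≡⟨ cong₂ (λ u v → fromℕ (suc M) * fromℕ (suc M) * u + v)
         (β≡centred n (2 ℕ.+ q) M refl)
         (β≡centred (suc n) q M (trans (ℕₚ.+-suc (n ℕ.* 2) (suc q)) (cong suc (ℕₚ.+-suc (n ℕ.* 2) q)))) ⟩
  fromℕ (suc M) * fromℕ (suc M) * (D * centred M (2 ℕ.+ q)) + (- fromℕ 4 * D) * centred M q
    ≡⟨ lemma (fromℕ (suc M)) D (centred M (2 ℕ.+ q)) (centred M q) ⟩
  (- fromℕ 4 * D) * (- (h * h) * centred M (2 ℕ.+ q) + centred M q)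
    ≡⟨ cong ((- fromℕ 4 * D) *_) (centred-suc-suc M q) ⟨
  (- fromℕ 4 * D) * centred (2 ℕ.+ M) (2 ℕ.+ q)
    ∎
  where
  open ≡-Reasoning
  M = n ℕ.* 2 ℕ.+ (2 ℕ.+ q)
  D = (- fromℕ 4) ^ n
  h = fromℕ (suc M) * ½
  lemma : ∀ m d p r → m * m * (d * p) + (- fromℕ 4 * d) * r ≡ (- fromℕ 4 * d) * (- ((m * ½) * (m * ½)) * p + r)
  lemma = solve-∀ ℚ-acr

-- Coefficients of the powers of arcsin t / t - 1.

dpow-arcsin : ∀ n q → dpow (suc q) arcsin (suc q ℕ.+ 2 ℕ.* n)
  ≡ (1 /! (suc q ℕ.+ 2 ℕ.* n)) * ((- fromℕ 4) ^ n * Q (suc q) (2 ℕ.* n) (fromℕ 2))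
dpow-arcsin n q = begin
  dpow (suc q) arcsin M                                   ≡⟨ const-*ₚ (1 /! suc q) (arcsin ^ₚ suc q) M ⟩
  b                                                       ≡⟨ ℚₚ.*-identityˡ b ⟨
  1ℚ * b                                                  ≡⟨ cong (_* b) (!-inverse M) ⟨
  fromℕ (M !) * (1 /! M) * b                              ≡⟨ lemma (fromℕ (M !)) (1 /! M) b ⟩
  (1 /! M) * β (suc q) M                                  ≡⟨ cong ((1 /! M) *_) (β≡centred n q (q ℕ.+ 2 ℕ.* n) index) ⟩
  (1 /! M) * ((- fromℕ 4) ^ n * centred (q ℕ.+ 2 ℕ.* n) q) ≡⟨ cong (λ t → (1 /! M) * ((- fromℕ 4) ^ n * t)) (Q≡centred q (2 ℕ.* n)) ⟨
  (1 /! M) * ((- fromℕ 4) ^ n * Q (suc q) (2 ℕ.* n) (fromℕ 2)) ∎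
  where
  open ≡-Reasoning
  M = suc q ℕ.+ 2 ℕ.* n
  b : ℚ
  b = (1 /! suc q) * (arcsin ^ₚ suc q) M
  lemma : ∀ a c d → a * c * d ≡ c * (a * d)
  lemma = solve-∀ ℚ-acr
  index : q ℕ.+ 2 ℕ.* n ≡ n ℕ.* 2 ℕ.+ q
  index = trans (ℕₚ.+-comm q (2 ℕ.* n)) (cong (ℕ._+ q) (ℕₚ.*-comm 2 n))

U : Poly
U zero    = 0ℚ
U (suc i) = V (suc i)

-- The Bell polynomial receives x_1, ..., x_d only, with d = m - k + 1, so its series is a
-- truncation of `U`. Since d + k = m + 1, `^ₚ-truncate` just covers degree m.
bell≡dpow-U : ∀ m k → k ≤ m → bell m k (λ i → x (suc (toℕ i))) ≡ fromℕ (m !) * dpow k U m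
bell≡dpow-U m k k≤m = begin
  bell m k v                                           ≡⟨ bell-coefficient m k v ⟩
  fromℕ (m !) * dpow k (bellSeries v) m                ≡⟨ cong (fromℕ (m !) *_) (const-*ₚ (1 /! k) (bellSeries v ^ₚ k) m) ⟩
  fromℕ (m !) * ((1 /! k) * (bellSeries v ^ₚ k) m)     ≡⟨ cong (λ t → fromℕ (m !) * ((1 /! k) * t)) truncate ⟩
  fromℕ (m !) * ((1 /! k) * (U ^ₚ k) m)                ≡⟨ cong (fromℕ (m !) *_) (const-*ₚ (1 /! k) (U ^ₚ k) m) ⟨
  fromℕ (m !) * dpow k U m                             ∎
  where
  open ≡-Reasoning
  d = suc (m ∸ k)
  v : Vector ℚ d
  v i = x (suc (toℕ i))
  agree : ∀ i → i ≤ d → bellSeries v i ≡ U i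
  agree zero    _   = bellSeries-zero v
  agree (suc i) i<d = bellSeries-suc d x i<d
  truncate : (bellSeries v ^ₚ k) m ≡ (U ^ₚ k) m
  truncate = ^ₚ-truncate {bellSeries v} {U} {d} (bellSeries-zero v) refl agree k m
    (ℕₚ.≤-reflexive (cong suc (sym (ℕₚ.m∸n+n≡m k≤m))))

X*U≗arcsin-X : X *ₚ U ≗ arcsin +ₚ (-ₚ X)
X*U≗arcsin-X zero          = X-*ₚ-zero U
X*U≗arcsin-X (suc zero)    = X-*ₚ U 0
X*U≗arcsin-X (suc (suc n)) = trans (X-*ₚ U (suc n)) (sym (ℚₚ.+-identityʳ (V (suc n))))

-X≗monomial : -ₚ X ≗ const (- 1ℚ) *ₚ (X ^ₚ 1)
-X≗monomial n = sym (trans (const-*ₚ (- 1ℚ) (X ^ₚ 1) n)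
  (trans (cong (- 1ℚ *_) (S.*-identityʳ X n)) (lemma (X n))))
  where
  lemma : ∀ a → - 1ℚ * a ≡ - a
  lemma = solve-∀ ℚ-acr

dpow-cong : ∀ k {F G} → F ≗ G → dpow k F ≗ dpow k G
dpow-cong k F≗G = S.*-congˡ {const (1 /! k)} (S^.^-congˡ k F≗G)

dpow-neg-X : ∀ j → dpow j (-ₚ X) ≗ const ((1 /! j) * (- 1ℚ) ^ j) *ₚ (X ^ₚ j)
dpow-neg-X j n = begin
  dpow j (-ₚ X) n                                       ≡⟨ dpow-cong j -X≗monomial n ⟩
  dpow j (const (- 1ℚ) *ₚ (X ^ₚ 1)) n                   ≡⟨ dpow-monomial j (- 1ℚ) 1 n ⟩
  (const ((1 /! j) * (- 1ℚ) ^ j) *ₚ (X ^ₚ (1 ℕ.* j))) n ≡⟨ cong (λ e → (const ((1 /! j) * (- 1ℚ) ^ j) *ₚ (X ^ₚ e)) n) (ℕₚ.*-identityˡ j) ⟩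
  (const ((1 /! j) * (- 1ℚ) ^ j) *ₚ (X ^ₚ j)) n         ∎
  where open ≡-Reasoning

dpow-X*ₚ : ∀ k F n → dpow k (X *ₚ F) (k ℕ.+ n) ≡ dpow k F n
dpow-X*ₚ k F n = begin
  dpow k (X *ₚ F) (k ℕ.+ n)                        ≡⟨ const-*ₚ (1 /! k) ((X *ₚ F) ^ₚ k) (k ℕ.+ n) ⟩
  (1 /! k) * ((X *ₚ F) ^ₚ k) (k ℕ.+ n)             ≡⟨ cong ((1 /! k) *_) (S^.^-distrib-* X F k (k ℕ.+ n)) ⟩
  (1 /! k) * ((X ^ₚ k) *ₚ (F ^ₚ k)) (k ℕ.+ n)      ≡⟨ cong ((1 /! k) *_) (X^-*ₚ k (F ^ₚ k) n) ⟩
  (1 /! k) * (F ^ₚ k) n                            ≡⟨ const-*ₚ (1 /! k) (F ^ₚ k) n ⟨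
  dpow k F n                                       ∎
  where open ≡-Reasoning

-- U = arcsin t / t - 1, so t U = arcsin t - t, to which the binomial theorem applies.
dpow-U : ∀ k n → dpow k U n
  ≡ ∑[ i ≤ k ] ((1 /! (k ∸ toℕ i)) * (- 1ℚ) ^ (k ∸ toℕ i) * dpow (toℕ i) arcsin (toℕ i ℕ.+ n))
dpow-U k n = begin
  dpow k U n
    ≡⟨ dpow-X*ₚ k U n ⟨
  dpow k (X *ₚ U) (k ℕ.+ n)
    ≡⟨ dpow-cong k X*U≗arcsin-X (k ℕ.+ n) ⟩
  dpow k (arcsin +ₚ (-ₚ X)) (k ℕ.+ n)
    ≡⟨ SD.dpow-+ k arcsin (-ₚ X) (k ℕ.+ n) ⟩
  SΣ.sum {suc k} (λ i → dpow (toℕ i) arcsin *ₚ dpow (k ∸ toℕ i) (-ₚ X)) (k ℕ.+ n)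
    ≡⟨ sum-coeff {suc k} (λ i → dpow (toℕ i) arcsin *ₚ dpow (k ∸ toℕ i) (-ₚ X)) (k ℕ.+ n) ⟩
  ∑[ i ≤ k ] ((dpow (toℕ i) arcsin *ₚ dpow (k ∸ toℕ i) (-ₚ X)) (k ℕ.+ n))
    ≡⟨ ℚΣ.sum-cong-≗ {suc k} (λ i → term (toℕ i) (ℕₚ.≤-pred (toℕ<n i))) ⟩
  ∑[ i ≤ k ] ((1 /! (k ∸ toℕ i)) * (- 1ℚ) ^ (k ∸ toℕ i) * dpow (toℕ i) arcsin (toℕ i ℕ.+ n))
    ∎
  where
  open ≡-Reasoning
  term : ∀ i → i ≤ k → (dpow i arcsin *ₚ dpow (k ∸ i) (-ₚ X)) (k ℕ.+ n)
    ≡ (1 /! (k ∸ i)) * (- 1ℚ) ^ (k ∸ i) * dpow i arcsin (i ℕ.+ n)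
  term i i≤k = begin
    (P *ₚ dpow j (-ₚ X)) (k ℕ.+ n)
      ≡⟨ S.*-congˡ {P} (dpow-neg-X j) (k ℕ.+ n) ⟩
    (P *ₚ (const c *ₚ (X ^ₚ j))) (k ℕ.+ n)
      ≡⟨ solve 3 (λ p a b → p :* (a :* b) := a :* (b :* p)) S.refl P (const c) (X ^ₚ j) (k ℕ.+ n) ⟩
    (const c *ₚ ((X ^ₚ j) *ₚ P)) (k ℕ.+ n)
      ≡⟨ const-*ₚ c ((X ^ₚ j) *ₚ P) (k ℕ.+ n) ⟩
    c * ((X ^ₚ j) *ₚ P) (k ℕ.+ n)
      -- The degree is rewritten as (k - i) + (i + n), so that the factor t^(k-i) coming from the
      -- power of -t can be stripped off.
      ≡⟨ cong (λ e → c * ((X ^ₚ j) *ₚ P) e) (trans (cong (ℕ._+ n) (sym (ℕₚ.m∸n+n≡m i≤k))) (ℕₚ.+-assoc j i n)) ⟩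
    c * ((X ^ₚ j) *ₚ P) (j ℕ.+ (i ℕ.+ n))
      ≡⟨ cong (c *_) (X^-*ₚ j P (i ℕ.+ n)) ⟩
    c * P (i ℕ.+ n)
      ∎
    where
    open SemiringSolver seriesSemiring using (solve; _:*_; _:=_)
    j = k ∸ i
    c : ℚ
    c = (1 /! j) * (- 1ℚ) ^ j
    P : Poly
    P = dpow i arcsin

-- Factorials, signs and the final formula.

[m*2]!!≡2^m*m! : ∀ m → (m ℕ.* 2) !! ≡ 2 ℕ.^ m ℕ.* m !
[m*2]!!≡2^m*m! zero    = refl
[m*2]!!≡2^m*m! (suc m) = trans
  (cong (suc (suc (m ℕ.* 2)) ℕ.*_) ([m*2]!!≡2^m*m! m))
  (lemma m (2 ℕ.^ m) (m !))
  where
  lemma : ∀ m a b → (2 ℕ.+ m ℕ.* 2) ℕ.* (a ℕ.* b) ≡ 2 ℕ.* a ℕ.* ((1 ℕ.+ m) ℕ.* b)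
  lemma = ℕRing.solve-∀

fromℕ-^ : ∀ a n → fromℕ (a ℕ.^ n) ≡ fromℕ a ^ n
fromℕ-^ a zero    = refl
fromℕ-^ a (suc n) = trans (fromℕ-* a (a ℕ.^ n)) (cong (fromℕ a *_) (fromℕ-^ a n))

-- The (2n)! of `bell-coefficient` and the 4^n contained in `β≡centred` together make up the double
-- factorial.
[4n]!! : ∀ n → fromℕ ((4 ℕ.* n) !!) ≡ fromℕ 4 ^ n * fromℕ ((2 ℕ.* n) !)
[4n]!! n = begin
  fromℕ ((4 ℕ.* n) !!)                              ≡⟨ cong (λ m → fromℕ (m !!)) (lemma n) ⟩
  fromℕ ((2 ℕ.* n ℕ.* 2) !!)                        ≡⟨ cong fromℕ ([m*2]!!≡2^m*m! (2 ℕ.* n)) ⟩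
  fromℕ (2 ℕ.^ (2 ℕ.* n) ℕ.* (2 ℕ.* n) !)           ≡⟨ fromℕ-* (2 ℕ.^ (2 ℕ.* n)) ((2 ℕ.* n) !) ⟩
  fromℕ (2 ℕ.^ (2 ℕ.* n)) * fromℕ ((2 ℕ.* n) !)     ≡⟨ cong (λ t → fromℕ t * fromℕ ((2 ℕ.* n) !)) (ℕₚ.^-*-assoc 2 2 n) ⟨
  fromℕ (4 ℕ.^ n) * fromℕ ((2 ℕ.* n) !)             ≡⟨ cong (_* fromℕ ((2 ℕ.* n) !)) (fromℕ-^ 4 n) ⟩
  fromℕ 4 ^ n * fromℕ ((2 ℕ.* n) !)                 ∎
  where
  open ≡-Reasoning
  lemma : ∀ n → 4 ℕ.* n ≡ 2 ℕ.* n ℕ.* 2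
  lemma = ℕRing.solve-∀

-1^n-square : ∀ n → (- 1ℚ) ^ n * (- 1ℚ) ^ n ≡ 1ℚ
-1^n-square zero    = refl
-1^n-square (suc n) = trans (lemma ((- 1ℚ) ^ n)) (-1^n-square n)
  where
  lemma : ∀ a → - 1ℚ * a * (- 1ℚ * a) ≡ a * a
  lemma = solve-∀ ℚ-acr

-- On the right, (-1)^n stems from (-4)^n and (-1)^(k-q) from the power of -t. The two sides differ
-- by (-1)^(2q) = 1.
signs : ∀ n k q → q ≤ k → (- 1ℚ) ^ (n ℕ.+ k) * (- 1ℚ) ^ q ≡ (- 1ℚ) ^ n * (- 1ℚ) ^ (k ∸ q)
signs n k q q≤k = begin
  σ (n ℕ.+ k) * σ q                   ≡⟨ cong (λ e → σ (n ℕ.+ e) * σ q) (ℕₚ.m∸n+n≡m q≤k) ⟨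
  σ (n ℕ.+ (k ∸ q ℕ.+ q)) * σ q       ≡⟨ cong (_* σ q) (trans (ℚ^.^-homo-* (- 1ℚ) n (k ∸ q ℕ.+ q)) (cong (σ n *_) (ℚ^.^-homo-* (- 1ℚ) (k ∸ q) q))) ⟩
  σ n * (σ (k ∸ q) * σ q) * σ q       ≡⟨ lemma (σ n) (σ (k ∸ q)) (σ q) ⟩
  σ n * σ (k ∸ q) * (σ q * σ q)       ≡⟨ cong (σ n * σ (k ∸ q) *_) (-1^n-square q) ⟩
  σ n * σ (k ∸ q) * 1ℚ                ≡⟨ ℚₚ.*-identityʳ (σ n * σ (k ∸ q)) ⟩
  σ n * σ (k ∸ q)                     ∎
  where
  open ≡-Reasoning
  σ : ℕ → ℚ
  σ j = (- 1ℚ) ^ j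
  lemma : ∀ a b c → a * (b * c) * c ≡ a * b * (c * c)
  lemma = solve-∀ ℚ-acr

[-4]^n : ∀ n → (- fromℕ 4) ^ n ≡ (- 1ℚ) ^ n * fromℕ 4 ^ n
[-4]^n n = ℚ^.^-distrib-* (- 1ℚ) (fromℕ 4) n

-- Merges the 1/(k-q)! of the binomial expansion with the 1/(q+2n)! of `dpow-arcsin`; the two
-- arguments add up to 2n + k.
binomial-quotient : ∀ n k q → q ≤ k →
  fromℕ ((2 ℕ.* n ℕ.+ k) C (k ∸ q)) * (1 /! (2 ℕ.* n ℕ.+ k)) ≡ (1 /! (k ∸ q)) * (1 /! (q ℕ.+ 2 ℕ.* n))
binomial-quotient n k q q≤k = trans
  (1/!-binomial (ℕₚ.≤-trans (ℕₚ.m∸n≤m k q) (ℕₚ.m≤n+m k (2 ℕ.* n))))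
  (cong (λ j → (1 /! (k ∸ q)) * (1 /! j)) (begin
    2 ℕ.* n ℕ.+ k ∸ (k ∸ q)       ≡⟨ ℕₚ.+-∸-assoc (2 ℕ.* n) (ℕₚ.m∸n≤m k q) ⟩
    2 ℕ.* n ℕ.+ (k ∸ (k ∸ q))     ≡⟨ cong (2 ℕ.* n ℕ.+_) (ℕₚ.m∸[m∸n]≡n q≤k) ⟩
    2 ℕ.* n ℕ.+ q                 ≡⟨ ℕₚ.+-comm (2 ℕ.* n) q ⟩
    q ℕ.+ 2 ℕ.* n                 ∎))
  where open ≡-Reasoning

theorem3p1 : (n k : ℕ) → 1 ≤ n → 1 ≤ k → k ≤ 2 ℕ.* n →
    bell (2 ℕ.* n) k (λ i → x (suc (toℕ i)))
    ≡ (- 1ℚ) ^ (n ℕ.+ k)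
    * (((4 ℕ.* n) !!) /! (2 ℕ.* n ℕ.+ k))
    * ∑[ j < k ]
    (let q = suc (toℕ j) in
    (- 1ℚ) ^ q
    * fromℕ ((2 ℕ.* n ℕ.+ k) C (k ∸ q))
    * Q q (2 ℕ.* n) (fromℕ 2))
theorem3p1 n@(suc n-1) k _ _ k≤2n = begin
  bell (2 ℕ.* n) k (λ i → x (suc (toℕ i)))
    ≡⟨ bell≡dpow-U (2 ℕ.* n) k k≤2n ⟩
  a * dpow k U (2 ℕ.* n)
    ≡⟨ cong (a *_) (dpow-U k (2 ℕ.* n)) ⟩
  a * (L 0 + ∑[ j < k ] L (suc (toℕ j)))
    ≡⟨ cong (λ t → a * (t + ∑[ j < k ] L (suc (toℕ j)))) L-zero ⟩
  a * (0ℚ + ∑[ j < k ] L (suc (toℕ j)))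
    ≡⟨ cong (a *_) (ℚₚ.+-identityˡ _) ⟩
  a * ∑[ j < k ] L (suc (toℕ j))
    ≡⟨ ℚΣ.*-distribˡ-sum {k} a (λ j → L (suc (toℕ j))) ⟩
  ∑[ j < k ] (a * L (suc (toℕ j)))
    ≡⟨ ℚΣ.sum-cong-≗ {k} (λ j → term (toℕ j) (toℕ<n j)) ⟩
  ∑[ j < k ] (c * R (suc (toℕ j)))
    ≡⟨ ℚΣ.*-distribˡ-sum {k} c (λ j → R (suc (toℕ j))) ⟨
  c * ∑[ j < k ] R (suc (toℕ j))
    ∎
  where
  open ≡-Reasoning
  m = 2 ℕ.* n ℕ.+ k
  a c : ℚ
  a = fromℕ ((2 ℕ.* n) !)
  c = (- 1ℚ) ^ (n ℕ.+ k) * (((4 ℕ.* n) !!) /! m)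
  L R : ℕ → ℚ
  L i = (1 /! (k ∸ i)) * (- 1ℚ) ^ (k ∸ i) * dpow i arcsin (i ℕ.+ 2 ℕ.* n)
  R q = (- 1ℚ) ^ q * fromℕ (m C (k ∸ q)) * Q q (2 ℕ.* n) (fromℕ 2)
  -- The term of arcsin^0 = 1 has no coefficient in degree 2n > 0, which is why the sum starts at q
  -- = 1. Matching n as a successor lets `1ₚ (2 ℕ.* n)` reduce to 0.
  L-zero : L 0 ≡ 0ℚ
  L-zero = trans
    (cong ((1 /! k) * (- 1ℚ) ^ k *_) (const-*ₚ (1 /! 0) 1ₚ (2 ℕ.* n)))
    (ℚₚ.*-zeroʳ ((1 /! k) * (- 1ℚ) ^ k))
  lemma₁ : ∀ a f s g u v z → a * (f * s * (g * ((u * v) * z))) ≡ (u * s) * (v * a) * (f * g) * z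
  lemma₁ = solve-∀ ℚ-acr
  lemma₂ : ∀ s t d b g z → (s * t) * d * (b * g) * z ≡ s * (d * g) * (t * b * z)
  lemma₂ = solve-∀ ℚ-acr
  term : ∀ j → j < k → a * L (suc j) ≡ c * R (suc j)
  term j j<k = begin
    a * (f * σ (k ∸ q) * dpow q arcsin (q ℕ.+ 2 ℕ.* n))
      ≡⟨ cong (λ t → a * (f * σ (k ∸ q) * t)) (dpow-arcsin n j) ⟩
    a * (f * σ (k ∸ q) * (g * ((- fromℕ 4) ^ n * z)))
      ≡⟨ cong (λ t → a * (f * σ (k ∸ q) * (g * (t * z)))) ([-4]^n n) ⟩
    a * (f * σ (k ∸ q) * (g * ((σ n * fromℕ 4 ^ n) * z)))
      ≡⟨ lemma₁ a f (σ (k ∸ q)) g (σ n) (fromℕ 4 ^ n) z ⟩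
    (σ n * σ (k ∸ q)) * (fromℕ 4 ^ n * a) * (f * g) * z
      ≡⟨ cong₂ (λ u v → u * v * (f * g) * z) (signs n k q j<k) ([4n]!! n) ⟨
    (σ (n ℕ.+ k) * σ q) * fromℕ ((4 ℕ.* n) !!) * (f * g) * z
      ≡⟨ cong (λ t → (σ (n ℕ.+ k) * σ q) * fromℕ ((4 ℕ.* n) !!) * t * z) (binomial-quotient n k q j<k) ⟨
    (σ (n ℕ.+ k) * σ q) * fromℕ ((4 ℕ.* n) !!) * (fromℕ (m C (k ∸ q)) * (1 /! m)) * z
      ≡⟨ lemma₂ (σ (n ℕ.+ k)) (σ q) (fromℕ ((4 ℕ.* n) !!)) (fromℕ (m C (k ∸ q))) (1 /! m) z ⟩
    σ (n ℕ.+ k) * (fromℕ ((4 ℕ.* n) !!) * (1 /! m)) * (σ q * fromℕ (m C (k ∸ q)) * z)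
      ≡⟨ cong (λ t → σ (n ℕ.+ k) * t * (σ q * fromℕ (m C (k ∸ q)) * z)) (/!≡*1/! ((4 ℕ.* n) !!) m) ⟨
    c * R q
      ∎
    where
    q = suc j
    σ : ℕ → ℚ
    σ i = (- 1ℚ) ^ i
    f g z : ℚ
    f = 1 /! (k ∸ q)
    g = 1 /! (q ℕ.+ 2 ℕ.* n)
    z = Q q (2 ℕ.* n) (fromℕ 2)
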